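{- Let $p$ be an odd prime and let $F\colon\mathbb{F}_{p^n}\to\mathbb{F}_{p^n}$ be a plateaued function such that $F(x)=F(-x)$ for all $x\in\mathbb{F}_{p^n}$. Then $F$ is planar if and only if $F$ is $2$-to-$1$.
   Context: Let $\zeta_p=e^{2\pi i/p}$ and let $\operatorname{Tr}$ be the absolute trace $\mathbb{F}_{p^n}\to\mathbb{F}_p$. The Walsh transform of $F$ is $W_F(b,a)=\sum_{x\in\mathbb{F}_{p^n}}\zeta_p^{\operatorname{Tr}(bF(x))-\operatorname{Tr}(ax)}$. $F$ is plateaued if for every $b\in\mathbb{F}_{p^n}^*$ there is an integer $s_b$ with $0\le s_b\le n$ such that $|W_F(b,a)|\in\{0,p^{(n+s_b)/2}\}$ for all $a\in\mathbb{F}_{p^n}$. $F$ is $2$-to-$1$ if exactly one element of $\mathbb{F}_{p^n}$ has exactly one preimage and $(p^n-1)/2$ elements have exactly $2$ preimages. $F$ is planar if for every $a\in\mathbb{F}_{p^n}^*$ and every $b\in\mathbb{F}_{p^n}$ the equation $F(x+a)-F(x)=b$ has exactly one solution $x$. -}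

module Defs where

open import Level using (Level; _⊔_) renaming (suc to lsuc; zero to 0ℓ)
open import Algebra.Bundles using (CommutativeRing; RawSemiring; Semiring)
open import Algebra.Structures using (IsCommutativeRing)
import Algebra.Definitions.RawSemiring as SemiringOps
open import Data.Fin.Base using (Fin; toℕ)
open import Data.Fin.Properties using (any?) renaming (_≟_ to _≟ᶠ_)
open import Data.List.Base using (List; tabulate; filter; length)
open import Data.Nat as ℕ using (ℕ)
open import Data.Nat.DivMod using (_/_)
open import Data.Product using (_×_; _,_; ∃; ∃-syntax; ∃!)
open import Data.Sum.Base using (_⊎_)
open import Function.Bundles using (_↔_; module Inverse)
open import Function.Properties.Inverse using (↔⇒↣)
open import Relation.Binary using (Rel; IsStrictPartialOrder; DecidableEquality)
open import Relation.Binary.Definitions using (Cotransitive)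
open import Relation.Binary.PropositionalEquality using (_≡_; _≢_)
open import Relation.Nullary using (¬_; yes; no)
open import Relation.Nullary.Decidable using (via-injection)
open import Relation.Unary using (Pred; Decidable)

-- The real numbers, given axiomatically as a Cauchy-complete Archimedean
-- ordered field.  The axioms are in constructive form (cotransitivity and
-- tightness of < instead of trichotomy, inverses of elements apart from 0);
-- classically they are the usual ones and determine ℝ up to isomorphism.
record RealNumbers c ℓ₁ ℓ₂ : Set (lsuc (c ⊔ ℓ₁ ⊔ ℓ₂)) where
  infix 4 _<_ _≤_
  field
    commutativeRing : CommutativeRing c ℓ₁

  open CommutativeRing commutativeRing public
  open SemiringOps (Semiring.rawSemiring semiring) public using () renaming (_×_ to _·_)

  fromℕ : ℕ → Carrier
  fromℕ m = m · 1#

  field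
    _<_                  : Rel Carrier ℓ₂
    isStrictPartialOrder : IsStrictPartialOrder _≈_ _<_
    <-cotrans            : Cotransitive _<_
    <-tight              : ∀ {x y} → ¬ x < y → ¬ y < x → x ≈ y
    0<1                  : 0# < 1#
    +-monoʳ-<            : ∀ z {x y} → x < y → z + x < z + y
    *-pos                : ∀ {x y} → 0# < x → 0# < y → 0# < x * y
    inverse              : ∀ {x} → x < 0# ⊎ 0# < x → ∃[ y ] x * y ≈ 1#

  _≤_ : Rel Carrier ℓ₂
  x ≤ y = ¬ y < x

  -- Both inequalities |f i − f j| < ε unfold to the one below, as i and j
  -- may be exchanged.
  Cauchy : (ℕ → Carrier) → Set (c ⊔ ℓ₂)
  Cauchy f = ∀ ε → 0# < ε →
    ∃[ N ] (∀ i j → N ℕ.≤ i → N ℕ.≤ j → f i - f j < ε)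

  _⟶_ : (ℕ → Carrier) → Carrier → Set (c ⊔ ℓ₂)
  f ⟶ x = ∀ ε → 0# < ε →
    ∃[ N ] (∀ i → N ℕ.≤ i → (f i - x < ε) × (x - f i < ε))

  -- √ is total, but only its values on nonnegative arguments are specified.
  field
    archimedean : ∀ x → ∃[ m ] x < fromℕ m
    complete    : ∀ f → Cauchy f → ∃[ x ] f ⟶ x
    √           : Carrier → Carrier
    √-cong      : ∀ {x y} → x ≈ y → √ x ≈ √ y
    √-nonneg    : ∀ {x} → 0# ≤ x → 0# ≤ √ x
    √-square    : ∀ {x} → 0# ≤ x → √ x * √ x ≈ x

module Complex {c ℓ₁ ℓ₂} (ℝ : RealNumbers c ℓ₁ ℓ₂) where
  open RealNumbers ℝ

  infix 8 _+i_

  record ℂ : Set c where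
    constructor _+i_
    field
      re im : Carrier

  open ℂ public

  rawSemiring-ℂ : RawSemiring c ℓ₁
  rawSemiring-ℂ = record
    { Carrier = ℂ
    ; _≈_     = λ z w → (re z ≈ re w) × (im z ≈ im w)
    ; _+_     = λ z w → (re z + re w) +i (im z + im w)
    ; _*_     = λ z w → (re z * re w - im z * im w) +i (re z * im w + im z * re w)
    ; 0#      = 0# +i 0#
    ; 1#      = 1# +i 0#
    }

  open RawSemiring rawSemiring-ℂ public
    using () renaming (_≈_ to _≈ᶜ_; 1# to 1ᶜ)
  open SemiringOps rawSemiring-ℂ public
    using () renaming (_^_ to _^ᶜ_; sum to sumᶜ)

  ∣_∣ : ℂ → Carrier
  ∣ z ∣ = √ (re z * re z + im z * im z)

  IsPrimitiveRoot : ℕ → ℂ → Set ℓ₁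
  IsPrimitiveRoot m ζ =
    (ζ ^ᶜ m ≈ᶜ 1ᶜ) × (∀ k → 0 ℕ.< k → k ℕ.< m → ¬ ζ ^ᶜ k ≈ᶜ 1ᶜ)

open Complex public using (ℂ; IsPrimitiveRoot)

-- A field with exactly q elements.
record FiniteField (q : ℕ) : Set₁ where
  infix  8 -_
  infixl 7 _*_
  infixl 6 _+_
  infix  4 _≟_
  field
    Carrier           : Set
    _+_ _*_           : Carrier → Carrier → Carrier
    -_                : Carrier → Carrier
    0# 1#             : Carrier
    isCommutativeRing : IsCommutativeRing _≡_ _+_ _*_ -_ 0# 1#
    0≢1               : 0# ≢ 1#
    inverse           : ∀ {x} → x ≢ 0# → ∃[ y ] x * y ≡ 1#
    enumeration       : Carrier ↔ Fin q

  commutativeRing : CommutativeRing 0ℓ 0ℓ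
  commutativeRing = record { isCommutativeRing = isCommutativeRing }

  open CommutativeRing commutativeRing public using (_-_; semiring)
  open SemiringOps (Semiring.rawSemiring semiring) public using (_^_; sum) renaming (_×_ to _·_)

  element : Fin q → Carrier
  element = Inverse.from enumeration

  _≟_ : DecidableEquality Carrier
  _≟_ = via-injection (↔⇒↣ enumeration) _≟ᶠ_

  count : ∀ {ℓ} {P : Pred Carrier ℓ} → Decidable P → ℕ
  count P? = length (filter P? (tabulate element))

module _ {q : ℕ} (𝔽 : FiniteField q) where
  open FiniteField 𝔽

  Planar : (Carrier → Carrier) → Set
  Planar F = ∀ a → a ≢ 0# → ∀ b → ∃! _≡_ (λ x → F (x + a) - F x ≡ b)

  Even : (Carrier → Carrier) → Set
  Even F = ∀ x → F x ≡ F (- x)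

  preimages : (Carrier → Carrier) → Carrier → ℕ
  preimages F y = count (λ x → F x ≟ y)

  TwoToOne : (Carrier → Carrier) → Set
  TwoToOne F =
    (count (λ y → preimages F y ℕ.≟ 1) ≡ 1) ×
    (count (λ y → preimages F y ℕ.≟ 2) ≡ (q ℕ.∸ 1) / 2)

module _ {p n : ℕ} (𝔽 : FiniteField (p ℕ.^ n)) where
  open FiniteField 𝔽

  -- The absolute trace x + x^p + … + x^(p^(n-1)), as an element of 𝔽 lying
  -- in the prime subfield.
  Tr : Carrier → Carrier
  Tr x = sum (λ (i : Fin n) → x ^ (p ℕ.^ toℕ i))

  -- Identifies the prime subfield with {0, …, p-1}: the t < p with t · 1 = u.
  -- The value 0 for u outside the prime subfield is a dummy; residue is only
  -- applied to differences of traces.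
  residue : Carrier → ℕ
  residue u with any? (λ (t : Fin p) → toℕ t · 1# ≟ u)
  ... | yes (t , _) = toℕ t
  ... | no _        = 0

  module _ {c ℓ₁ ℓ₂} (ℝ : RealNumbers c ℓ₁ ℓ₂) (ζ : ℂ ℝ) where
    open RealNumbers ℝ using (_≈_; fromℕ; √) renaming (0# to 0ʳ)
    open Complex ℝ using (_^ᶜ_; sumᶜ; ∣_∣)

    Walsh : (Carrier → Carrier) → Carrier → Carrier → ℂ ℝ
    Walsh F b a = sumᶜ (λ i → let x = element i in
      ζ ^ᶜ residue (Tr (b * F x) - Tr (a * x)))

    -- √ (p ^ (n + s)) is p^((n+s)/2).
    Plateaued : (Carrier → Carrier) → Set ℓ₁
    Plateaued F = ∀ b → b ≢ 0# → ∃[ s ] (s ℕ.≤ n) ×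
      (∀ a → (∣ Walsh F b a ∣ ≈ 0ʳ) ⊎
             (∣ Walsh F b a ∣ ≈ √ (fromℕ (p ℕ.^ (n ℕ.+ s)))))

{-# OPTIONS --safe #-}

-- If F is even and planar, then F x = F y with x ≠ y makes both x and -y solutions z of
-- F (z + (y - x)) = F z, so y = -x and the fibres of F are the sets {x , -x}.
--
-- Conversely let F be 2-to-1, let q = p^n and let N_b = |W_F(b,0)|².  Since F has one fibre of size 1
-- and the others have size 2, N_b = 1 + 2 S(b) with S a sum of additive characters, so N_b^(2^j) is
-- 1 + 2^(j+1) times such a sum, and Σ_b N_b^(2^j) ≡ q modulo 2^(j+1).  Each N_b is 0 or odd, so this sum is
-- also congruent to the number of b with N_b ≠ 0; hence N_b ≠ 0 for all b, and no fact about the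
-- irreducibility of cyclotomic polynomials is needed.  Now N_b ≥ q for b ≠ 0, N_0 = q², and
-- Σ_b N_b = q (2q - 1) by counting the pairs with F x = F y, so N_b = q for b ≠ 0.  Therefore
-- |W_F(b,a)|² ∈ {0 , q}, Parseval's identity gives |W_F(b,a)|² = q for all a and all b ≠ 0, and Fourier
-- inversion shows that F (x + a) - F x = v has exactly one solution for each a ≠ 0 and each v.
module Submission where

open import Defs
open import Algebra.Bundles using (CommutativeMonoid; CommutativeRing; RawSemiring)
open import Algebra.Solver.Ring.AlmostCommutativeRing using (fromCommutativeRing; _-Raw-AlmostCommutative⟶_)
open import Algebra.Structures using (IsCommutativeRing)
import Algebra.Properties.AbelianGroup as AbelianGroupProperties
import Algebra.Properties.CommutativeMonoid.Mult as CommutativeMonoidMult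
import Algebra.Properties.CommutativeMonoid.Sum as MonoidSum
import Algebra.Properties.CommutativeSemigroup as CommutativeSemigroupProperties
import Algebra.Properties.CommutativeSemiring.Binomial as Binomial
import Algebra.Properties.CommutativeSemiring.Exp as CommutativeSemiringExp
import Algebra.Properties.Group as GroupProperties
import Algebra.Properties.Monoid.Mult as MonoidMult
import Algebra.Properties.Ring as RingProperties
import Algebra.Properties.Semiring.Exp as SemiringExp
import Algebra.Properties.Semiring.Mult as SemiringMult
import Algebra.Properties.Semiring.Sum as SemiringSum
import Algebra.Solver.Ring as RingSolver
open import Data.Bool.Base using (if_then_else_; true; false)
open import Data.Fin.Base using (Fin; zero; suc; punchIn; toℕ; fromℕ<; inject₁)
open import Data.Fin.Properties
  using (punchInᵢ≢i; toℕ<n; toℕ-fromℕ; toℕ-inject₁; toℕ-injective; toℕ-fromℕ<; any?; ¬∀⟶∃¬; suc-injective)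
open import Data.Integer.Base as ℤ using (ℤ; -[1+_]; 0ℤ)
import Data.Integer.Properties as ℤ
open import Data.List.Base using (List; []; _∷_; _++_; map; length; filter; tabulate)
import Data.Maybe.Base as Maybe
open import Data.Nat as ℕ using (ℕ; zero; suc; z≤n; s≤s; NonZero; _!)
open import Data.Nat.Combinatorics using (_C_; nCk≡n!/k![n-k]!; k![n∸k]!∣n!; nCn≡1)
open import Data.Nat.Coprimality using (prime⇒coprime; coprime-Bézout)
open import Data.Nat.Divisibility using (_∣_; divides; ∣⇒≤; m∣m*n)
open import Data.Nat.DivMod
  using (_/_; _%_; m≡m%n+[m/n]*n; m%n<n; m/n*n≡m; m*n/n≡m; m<n⇒m%n≡m; [m+kn]%n≡m%n)
open import Data.Nat.GCD using (module Bézout)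
open import Data.Nat.Primality using (Prime; euclidsLemma; prime⇒nonZero; prime⇒nonTrivial)
import Data.Nat.Properties as ℕ
open import Data.Nat.Solver using (module +-*-Solver)
open import Data.Product using (_,_; _×_; ∃-syntax; ∃!; proj₁; proj₂)
import Data.Sign.Base as Sign
open import Data.Sum.Base as Sum using (_⊎_; inj₁; inj₂)
open import Function.Base using (_∘_)
open import Function.Bundles using (_↔_; _⇔_; mk⇔; module Inverse)
open import Relation.Binary using (IsStrictPartialOrder)
open import Relation.Binary.Consequences using (dec⇒weaklyDec)
open import Relation.Binary.Definitions using (tri<; tri≈; tri>)
open import Relation.Binary.PropositionalEquality as ≡ using (_≡_; _≢_; cong; cong₂; sym; trans; refl)
open import Relation.Nullary using (Dec; yes; no; ¬_; contradiction; does)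
open import Relation.Unary using (Pred; Decidable)

-- That no `N_b` vanishes would classically follow from `N_b ≡ 1` modulo 2 in the ring generated by
-- `ζ`, whose rational elements are integers. Here integrality comes from summing over `b`: by
-- orthogonality, a combination of characters with coefficients in ℕ sums to a natural multiple of
-- q. Summation loses sight of the individual `b`; the high powers recover it, because every `N_b`
-- then contributes exactly 0 or 1 modulo 2^(j+1). For j = q the modulus exceeds q, so the
-- congruence fixes the number of nonzero `N_b` as q. The lower bound q is attained everywhere
-- because it is also the mean: the q - 1 energies with `b ≠ 0` add up to q(2q - 1) - q² = q(q - 1).
-- Equality and order of the reals are not decidable, so every comparison is made in ℕ. The
-- character sums live in an arbitrary commutative ring of characteristic zero, with negation of the
-- argument of the character in the place of complex conjugation.

-- Coefficients in ℤ let the ring solver cancel terms over a ring without decidable equality.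
module IntegerSolver {c ℓ} (R : CommutativeRing c ℓ) where
  open CommutativeRing R renaming (refl to ≈-refl; sym to ≈-sym; trans to ≈-trans)
  open SemiringMult semiring renaming (_×_ to _·_)
  open AbelianGroupProperties +-abelianGroup using (⁻¹-∙-comm; ε⁻¹≈ε; ⁻¹-involutive)
  open RingProperties ring using (-‿distribˡ-*; -‿distribʳ-*)
  open CommutativeSemigroupProperties +-commutativeSemigroup using (interchange)
  open import Relation.Binary.Reasoning.Setoid setoid

  ⟦_⟧ : ℤ → Carrier
  ⟦ ℤ.+ n      ⟧ = n · 1#
  ⟦ -[1+ n ] ⟧ = - (suc n · 1#)

  ⟦⟧-⊖ : ∀ m n → ⟦ m ℤ.⊖ n ⟧ ≈ m · 1# - n · 1#
  ⟦⟧-⊖ m       zero    = ≈-sym (≈-trans (+-congˡ ε⁻¹≈ε) (+-identityʳ _))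
  ⟦⟧-⊖ zero    (suc n) = ≈-sym (+-identityˡ _)
  ⟦⟧-⊖ (suc m) (suc n) rewrite ℤ.[1+m]⊖[1+n]≡m⊖n m n = begin
    ⟦ m ℤ.⊖ n ⟧                               ≈⟨ ⟦⟧-⊖ m n ⟩
    m · 1# - n · 1#                         ≈⟨ +-identityˡ _ ⟨
    0# + (m · 1# - n · 1#)                  ≈⟨ +-congʳ (-‿inverseʳ 1#) ⟨
    (1# - 1#) + (m · 1# - n · 1#)           ≈⟨ interchange _ _ _ _ ⟩
    (1# + m · 1#) + (- 1# + - (n · 1#))     ≈⟨ +-congˡ (⁻¹-∙-comm _ _) ⟩
    suc m · 1# - suc n · 1#                 ∎

  ⟦⟧-neg : ∀ i → ⟦ ℤ.- i ⟧ ≈ - ⟦ i ⟧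
  ⟦⟧-neg (ℤ.+ zero)  = ≈-sym ε⁻¹≈ε
  ⟦⟧-neg (ℤ.+ suc n) = ≈-refl
  ⟦⟧-neg -[1+ n ]  = ≈-sym (⁻¹-involutive _)

  ⟦⟧-+ : ∀ i j → ⟦ i ℤ.+ j ⟧ ≈ ⟦ i ⟧ + ⟦ j ⟧
  ⟦⟧-+ (ℤ.+ m)    (ℤ.+ n)    = ×-homo-+ 1# m n
  ⟦⟧-+ (ℤ.+ m)    -[1+ n ] = ⟦⟧-⊖ m (suc n)
  ⟦⟧-+ -[1+ m ] (ℤ.+ n)    = ≈-trans (⟦⟧-⊖ n (suc m)) (+-comm _ _)
  ⟦⟧-+ -[1+ m ] -[1+ n ] = begin
    - (suc (suc (m ℕ.+ n)) · 1#)            ≡⟨ ≡.cong (λ k → - (suc k · 1#)) (≡.sym (ℕ.+-suc m n)) ⟩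
    - ((suc m ℕ.+ suc n) · 1#)              ≈⟨ -‿cong (×-homo-+ 1# (suc m) (suc n)) ⟩
    - (suc m · 1# + suc n · 1#)             ≈⟨ ⁻¹-∙-comm _ _ ⟨
    - (suc m · 1#) + - (suc n · 1#)         ∎

  ⟦⟧-neg-* : ∀ m n → ⟦ Sign.- ℤ.◃ (m ℕ.* n) ⟧ ≈ - ((m · 1#) * (n · 1#))
  ⟦⟧-neg-* m n = begin
    ⟦ Sign.- ℤ.◃ (m ℕ.* n) ⟧                ≡⟨ ≡.cong ⟦_⟧ (ℤ.-◃n≡-n (m ℕ.* n)) ⟩
    ⟦ ℤ.- (ℤ.+ (m ℕ.* n)) ⟧                   ≈⟨ ⟦⟧-neg (ℤ.+ (m ℕ.* n)) ⟩
    - ((m ℕ.* n) · 1#)                      ≈⟨ -‿cong (×1-homo-* m n) ⟩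
    - ((m · 1#) * (n · 1#))                 ∎

  ⟦⟧-* : ∀ i j → ⟦ i ℤ.* j ⟧ ≈ ⟦ i ⟧ * ⟦ j ⟧
  ⟦⟧-* (ℤ.+ m)    (ℤ.+ n)    = ≈-trans (reflexive (≡.cong ⟦_⟧ (ℤ.+◃n≡+n (m ℕ.* n)))) (×1-homo-* m n)
  ⟦⟧-* (ℤ.+ m)    -[1+ n ] = ≈-trans (⟦⟧-neg-* m (suc n)) (-‿distribʳ-* _ _)
  ⟦⟧-* -[1+ m ] (ℤ.+ n)    = ≈-trans (⟦⟧-neg-* (suc m) n) (-‿distribˡ-* _ _)
  ⟦⟧-* -[1+ m ] -[1+ n ] = begin
    (suc m ℕ.* suc n) · 1#                  ≈⟨ ×1-homo-* (suc m) (suc n) ⟩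
    (suc m · 1#) * (suc n · 1#)             ≈⟨ ⁻¹-involutive _ ⟨
    - (- ((suc m · 1#) * (suc n · 1#)))     ≈⟨ -‿cong (-‿distribʳ-* _ _) ⟩
    - ((suc m · 1#) * - (suc n · 1#))       ≈⟨ -‿distribˡ-* _ _ ⟩
    - (suc m · 1#) * - (suc n · 1#)         ∎

  morphism : CommutativeRing.rawRing ℤ.+-*-commutativeRing -Raw-AlmostCommutative⟶ fromCommutativeRing R
  morphism = record
    { ⟦_⟧    = ⟦_⟧
    ; +-homo = ⟦⟧-+
    ; *-homo = ⟦⟧-*
    ; -‿homo = ⟦⟧-neg
    ; 0-homo = ≈-refl
    ; 1-homo = +-identityʳ 1#
    }

  open RingSolver _ _ morphism
    (λ i j → Maybe.map (λ i≡j → reflexive (≡.cong ⟦_⟧ i≡j)) (dec⇒weaklyDec ℤ._≟_ i j)) public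
    using (solve; _:=_; _:+_; _:*_; _:-_; :-_; con)

-- Finite sums and fibre counts

module FiniteSum {c ℓ} (M : CommutativeMonoid c ℓ) {q} {A : Set} (enumeration : A ↔ Fin q) where
  open CommutativeMonoid M renaming (refl to ≈-refl; sym to ≈-sym; trans to ≈-trans)
  open MonoidSum M
  open import Algebra.Properties.Monoid.Mult monoid using () renaming (_×_ to _·_)
  open Inverse enumeration using (to; from; strictlyInverseʳ; strictlyInverseˡ)

  private
    sum-single : ∀ {m} (f : Fin m → Carrier) i → (∀ j → j ≢ i → f j ≈ ε) → sum f ≈ f i
    sum-single {suc m} f i f≈ε = ≈-trans (sum-remove {i = i} f)
      (≈-trans (∙-congˡ (≈-trans (sum-cong-≋ (λ j → f≈ε (punchIn i j) (punchInᵢ≢i i j))) (sum-replicate-zero m)))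
             (identityʳ (f i)))

  -- Opaque, so that unification can read f off from ∑ f.
  opaque
    ∑ : (A → Carrier) → Carrier
    ∑ f = sum (f ∘ from)

    ∑≡sum : ∀ f → ∑ f ≡ sum (f ∘ from)
    ∑≡sum f = ≡.refl

    ∑-cong : ∀ {f g} → (∀ x → f x ≈ g x) → ∑ f ≈ ∑ g
    ∑-cong f≈g = sum-cong-≋ (f≈g ∘ from)

    ∑-∙ : ∀ f g → ∑ (λ x → f x ∙ g x) ≈ ∑ f ∙ ∑ g
    ∑-∙ f g = ∑-distrib-+ (f ∘ from) (g ∘ from)

    ∑-swap : ∀ (f : A → A → Carrier) → ∑ (λ x → ∑ (λ y → f x y)) ≈ ∑ (λ y → ∑ (λ x → f x y))
    ∑-swap f = ∑-comm {q} {q} (λ i j → f (from i) (from j))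

    ∑-const : ∀ x → ∑ (λ _ → x) ≈ q · x
    ∑-const x = sum-replicate q

    ∑-ε : ∀ {f} → (∀ x → f x ≈ ε) → ∑ f ≈ ε
    ∑-ε f≈ε = ≈-trans (∑-cong f≈ε) (sum-replicate-zero q)

    ∑-reindex : ∀ {f} (σ τ : A → A) → (∀ x → σ (τ x) ≡ x) → (∀ x → τ (σ x) ≡ x) → ∑ f ≈ ∑ (f ∘ σ)
    ∑-reindex {f} σ τ στ τσ = ≈-trans (sum-permute (f ∘ from) π)
      (sum-cong-≋ (λ i → reflexive (≡.cong f (strictlyInverseʳ (σ (from i))))))
      where
      π : Fin q ↔ Fin q
      π = record
        { to        = to ∘ σ ∘ from
        ; from      = to ∘ τ ∘ from
        ; to-cong   = ≡.cong _
        ; from-cong = ≡.cong _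
        ; inverse   = (λ { ≡.refl → cancel {σ} {τ} στ _ }) , (λ { ≡.refl → cancel {τ} {σ} τσ _ })
        }
        where
        cancel : ∀ {α β : A → A} → (∀ x → α (β x) ≡ x) → ∀ i → to (α (from (to (β (from i))))) ≡ i
        cancel {α} {β} αβ i = ≡.trans (≡.cong (to ∘ α) (strictlyInverseʳ (β (from i))))
                              (≡.trans (≡.cong to (αβ (from i))) (strictlyInverseˡ i))

    ∑-single : ∀ {f} a → (∀ x → x ≢ a → f x ≈ ε) → ∑ f ≈ f a
    ∑-single {f} a f≈ε = ≈-trans
      (sum-single (f ∘ from) (to a) (λ j j≢ → f≈ε (from j) (λ from-j≡a →
        j≢ (≡.trans (≡.sym (strictlyInverseˡ j)) (≡.cong to from-j≡a)))))
      (reflexive (≡.cong f (strictlyInverseʳ a)))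

open MonoidSum ℕ.+-0-commutativeMonoid using () renaming (sum to sumℕ)

𝟙 : ∀ {a} {P : Set a} → Dec P → ℕ
𝟙 P? = if does P? then 1 else 0

𝟙-yes : ∀ {a} {P : Set a} (P? : Dec P) → P → 𝟙 P? ≡ 1
𝟙-yes (yes _) _ = refl
𝟙-yes (no ¬p) p = contradiction p ¬p

𝟙-no : ∀ {a} {P : Set a} (P? : Dec P) → ¬ P → 𝟙 P? ≡ 0
𝟙-no (yes p) ¬p = contradiction p ¬p
𝟙-no (no _)  _  = refl

length-filter-tabulate : ∀ {a p} {A : Set a} {P : Pred A p} (P? : Decidable P) {m} (f : Fin m → A) →
                         length (filter P? (tabulate f)) ≡ sumℕ (λ i → 𝟙 (P? (f i)))
length-filter-tabulate P? {zero}  f = refl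
length-filter-tabulate P? {suc m} f with does (P? (f zero))
... | true  = cong suc (length-filter-tabulate P? (f ∘ suc))
... | false = length-filter-tabulate P? (f ∘ suc)

sum-mono-≤ : ∀ {m} {f g : Fin m → ℕ} → (∀ i → f i ℕ.≤ g i) → sumℕ f ℕ.≤ sumℕ g
sum-mono-≤ {zero}  f≤g = z≤n
sum-mono-≤ {suc m} f≤g = ℕ.+-mono-≤ (f≤g zero) (sum-mono-≤ (f≤g ∘ suc))

+-≤-≡ : ∀ {a b c d} → a ℕ.≤ b → c ℕ.≤ d → a ℕ.+ c ≡ b ℕ.+ d → a ≡ b × c ≡ d
+-≤-≡ {a} {b} {c} {d} a≤b c≤d eq = a≡b , ℕ.+-cancelˡ-≡ a c d (trans eq (cong (ℕ._+ d) (sym a≡b)))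
  where
  a≡b : a ≡ b
  a≡b = ℕ.≤-antisym a≤b (ℕ.+-cancelʳ-≤ d b a (ℕ.≤-trans (ℕ.≤-reflexive (sym eq)) (ℕ.+-monoʳ-≤ a c≤d)))

sum-≤-≡ : ∀ {m} {f g : Fin m → ℕ} → (∀ i → f i ℕ.≤ g i) → sumℕ f ≡ sumℕ g → ∀ i → f i ≡ g i
sum-≤-≡ {suc m} {f} {g} f≤g eq = λ { zero → proj₁ split ; (suc i) → sum-≤-≡ (f≤g ∘ suc) (proj₂ split) i }
  where split = +-≤-≡ (f≤g zero) (sum-mono-≤ (f≤g ∘ suc)) eq

sum≡0 : ∀ {m} {f : Fin m → ℕ} → sumℕ f ≡ 0 → ∀ i → f i ≡ 0
sum≡0 {suc m} {f} eq zero    = ℕ.m+n≡0⇒m≡0 (f zero) eq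
sum≡0 {suc m} {f} eq (suc i) = sum≡0 (ℕ.m+n≡0⇒n≡0 (f zero) eq) i

sum≡1 : ∀ {m} {f : Fin m → ℕ} → sumℕ f ≡ 1 → ∃[ i ] f i ≡ 1 × (∀ j → f j ≢ 0 → i ≡ j)
sum≡1 {suc m} {f} eq with f zero in f₀
... | zero with i , fᵢ , unique ← sum≡1 {f = f ∘ suc} eq =
  suc i , fᵢ , λ { zero f₀≢0 → contradiction f₀ f₀≢0 ; (suc j) fⱼ≢0 → cong suc (unique j fⱼ≢0) }
... | suc k = zero , trans f₀ (cong suc (ℕ.m+n≡0⇒m≡0 k (ℕ.suc-injective eq))) ,
  λ { zero _ → refl ; (suc j) fⱼ≢0 → contradiction (sum≡0 (ℕ.m+n≡0⇒n≡0 k (ℕ.suc-injective eq)) j) fⱼ≢0 }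

open MonoidMult ℕ.+-0-monoid using () renaming (_×_ to _·ℕ_)

·≡* : ∀ m x → m ·ℕ x ≡ m ℕ.* x
·≡* zero    x = refl
·≡* (suc m) x = cong (x ℕ.+_) (·≡* m x)

module Fibres {q} (𝔽 : FiniteField q) where
  open FiniteField 𝔽 using (Carrier; enumeration; element; count)
  open Inverse enumeration using (to; strictlyInverseʳ)
  open FiniteSum ℕ.+-0-commutativeMonoid enumeration public

  count≡∑ : ∀ {ℓ} {P : Pred Carrier ℓ} (P? : Decidable P) → count P? ≡ ∑ (λ x → 𝟙 (P? x))
  count≡∑ P? = trans (length-filter-tabulate P? element) (sym (∑≡sum (λ x → 𝟙 (P? x))))

  -- The rigidity behind every extremal count of the proof: the fibre sizes of a 2-to-1 function,
  -- the nonvanishing of the energies, their minimality, and the flatness of the Walsh spectrum.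
  ∑-≤-≡ : ∀ {f g : Carrier → ℕ} → (∀ x → f x ℕ.≤ g x) → ∑ f ≡ ∑ g → ∀ x → f x ≡ g x
  ∑-≤-≡ {f} {g} f≤g eq x = ≡.subst (λ y → f y ≡ g y) (strictlyInverseʳ x)
    (sum-≤-≡ (f≤g ∘ element) (trans (sym (∑≡sum f)) (trans eq (∑≡sum g))) (to x))

  ∑-mono-≤ : ∀ {f g : Carrier → ℕ} → (∀ x → f x ℕ.≤ g x) → ∑ f ℕ.≤ ∑ g
  ∑-mono-≤ {f} {g} f≤g = ≡.subst₂ ℕ._≤_ (sym (∑≡sum f)) (sym (∑≡sum g)) (sum-mono-≤ (f≤g ∘ element))

  ∑-const-* : ∀ x → ∑ (λ _ → x) ≡ q ℕ.* x
  ∑-const-* x = trans (∑-const x) (·≡* q x)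

  count≡1⇒∃! : ∀ {ℓ} {P : Pred Carrier ℓ} (P? : Decidable P) → count P? ≡ 1 → ∃! _≡_ P
  count≡1⇒∃! {P = P} P? eq with i , 𝟙≡1 , unique ← sum≡1 (trans (sym (length-filter-tabulate P? element)) eq) =
    element i , holds , λ {y} py →
      trans (cong element (unique (to y) (λ 𝟙≡0 → ℕ.1+n≢0 (trans (sym (𝟙-yes (P? _) (≡.subst P (sym (strictlyInverseʳ y)) py))) 𝟙≡0))))
            (strictlyInverseʳ y)
    where
    holds : P (element i)
    -- In the `no` case `𝟙≡1` would read `0 ≡ 1`, so `yes` covers everything.
    holds with yes p ← P? (element i) = p

module FibreSum {q} (𝔽 : FiniteField q) {c ℓ} (M : CommutativeMonoid c ℓ) where
  open CommutativeMonoid M renaming (Carrier to A; refl to ≈-refl; sym to ≈-sym; trans to ≈-trans)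
  open MonoidMult monoid using (×-homo-+; ×-congˡ) renaming (_×_ to _·_)
  open MonoidSum M using (sum)
  open FiniteField 𝔽 using (Carrier; enumeration; element; _≟_)
  open FiniteSum M enumeration
  module ∑ℕ = Fibres 𝔽
  open import Relation.Binary.Reasoning.Setoid setoid

  ∑-· : ∀ (n : Carrier → ℕ) x → ∑ (λ y → n y · x) ≈ ∑ℕ.∑ n · x
  ∑-· n x = ≈-trans (reflexive (∑≡sum _)) (≈-trans (sum-· (n ∘ element)) (×-congˡ (sym (∑ℕ.∑≡sum n))))
    where
    sum-· : ∀ {m} (n : Fin m → ℕ) → sum (λ i → n i · x) ≈ sumℕ n · x
    sum-· {zero}  n = ≈-refl
    sum-· {suc m} n = ≈-trans (∙-congˡ (sum-· (n ∘ suc))) (≈-sym (×-homo-+ x (n zero) (sumℕ (n ∘ suc))))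

  ∑-δ : ∀ (g : Carrier → A) a → ∑ (λ y → 𝟙 (a ≟ y) · g y) ≈ g a
  ∑-δ g a = begin
    ∑ (λ y → 𝟙 (a ≟ y) · g y)  ≈⟨ ∑-single a (λ y y≢a → ×-congˡ (𝟙-no (a ≟ y) (y≢a ∘ sym))) ⟩
    𝟙 (a ≟ a) · g a            ≈⟨ ×-congˡ (𝟙-yes (a ≟ a) refl) ⟩
    1 · g a                    ≈⟨ identityʳ (g a) ⟩
    g a                        ∎

  -- Writing `g (f x)` as a sum over `y` against the indicator of `f x ≡ y` and exchanging the two
  -- sums groups the points `x` by fibre.
  ∑-preimages : ∀ f (g : Carrier → A) → ∑ (g ∘ f) ≈ ∑ (λ y → preimages 𝔽 f y · g y)
  ∑-preimages f g = begin
    ∑ (λ x → g (f x))                          ≈⟨ ∑-cong (λ x → ∑-δ g (f x)) ⟨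
    ∑ (λ x → ∑ (λ y → 𝟙 (f x ≟ y) · g y))      ≈⟨ ∑-swap (λ x y → 𝟙 (f x ≟ y) · g y) ⟩
    ∑ (λ y → ∑ (λ x → 𝟙 (f x ≟ y) · g y))      ≈⟨ ∑-cong (λ y → ∑-· (λ x → 𝟙 (f x ≟ y)) (g y)) ⟩
    ∑ (λ y → ∑ℕ.∑ (λ x → 𝟙 (f x ≟ y)) · g y)   ≈⟨ ∑-cong (λ y → ×-congˡ {g y} (∑ℕ.count≡∑ (λ x → f x ≟ y))) ⟨
    ∑ (λ y → preimages 𝔽 f y · g y)            ∎

-- Powers modulo powers of 2

Odd : ℕ → Set
Odd n = ∃[ k ] n ≡ 1 ℕ.+ 2 ℕ.* k

-- (1 + 2mt)² = 1 + 4m(t + mt²), so each squaring gains a factor 2.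
odd^2^ : ∀ j m t → ∃[ u ] (1 ℕ.+ 2 ℕ.* m ℕ.* t) ℕ.^ (2 ℕ.^ j) ≡ 1 ℕ.+ 2 ℕ.^ j ℕ.* (2 ℕ.* m) ℕ.* u
odd^2^ zero    m t = t , ≡.trans (ℕ.^-identityʳ _) (cong (λ k → 1 ℕ.+ k ℕ.* t) (≡.sym (ℕ.*-identityˡ (2 ℕ.* m))))
odd^2^ (suc j) m t with u , eq ← odd^2^ j (2 ℕ.* m) (t ℕ.+ m ℕ.* t ℕ.* t) = u , (begin
  n ℕ.^ (2 ℕ.* 2 ℕ.^ j)                                              ≡⟨ ℕ.^-*-assoc n 2 (2 ℕ.^ j) ⟨
  (n ℕ.^ 2) ℕ.^ (2 ℕ.^ j)                                            ≡⟨ cong (ℕ._^ (2 ℕ.^ j)) (square m t) ⟩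
  (1 ℕ.+ 2 ℕ.* (2 ℕ.* m) ℕ.* (t ℕ.+ m ℕ.* t ℕ.* t)) ℕ.^ (2 ℕ.^ j)    ≡⟨ eq ⟩
  1 ℕ.+ 2 ℕ.^ j ℕ.* (2 ℕ.* (2 ℕ.* m)) ℕ.* u                          ≡⟨ regroup (2 ℕ.^ j) m u ⟩
  1 ℕ.+ 2 ℕ.^ (suc j) ℕ.* (2 ℕ.* m) ℕ.* u                            ∎)
  where
  open ≡.≡-Reasoning
  open +-*-Solver
  n = 1 ℕ.+ 2 ℕ.* m ℕ.* t
  square : ∀ m t → (1 ℕ.+ 2 ℕ.* m ℕ.* t) ℕ.^ 2 ≡ 1 ℕ.+ 2 ℕ.* (2 ℕ.* m) ℕ.* (t ℕ.+ m ℕ.* t ℕ.* t)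
  square = solve 2 (λ m t → (con 1 :+ con 2 :* m :* t) :^ 2
    := con 1 :+ con 2 :* (con 2 :* m) :* (t :+ m :* t :* t)) ≡.refl
  regroup : ∀ p m u → 1 ℕ.+ p ℕ.* (2 ℕ.* (2 ℕ.* m)) ℕ.* u ≡ 1 ℕ.+ (2 ℕ.* p) ℕ.* (2 ℕ.* m) ℕ.* u
  regroup = solve 3 (λ p m u → con 1 :+ p :* (con 2 :* (con 2 :* m)) :* u
    := con 1 :+ (con 2 :* p) :* (con 2 :* m) :* u) ≡.refl

-- For `n` zero or odd this is the residue of `n ^ (2 ^ j)` modulo `2 ^ (j + 1)`, so a sum of such
-- powers counts the nonzero terms.
sign : ℕ → ℕ
sign zero    = 0
sign (suc _) = 1

sign≤1 : ∀ n → sign n ℕ.≤ 1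
sign≤1 zero    = z≤n
sign≤1 (suc _) = s≤s z≤n

n<2^n : ∀ n → n ℕ.< 2 ℕ.^ n
n<2^n zero    = s≤s z≤n
n<2^n (suc n) = ℕ.+-mono-≤ (ℕ.≤-trans (s≤s z≤n) (n<2^n n)) (ℕ.≤-trans (n<2^n n) (ℕ.m≤m+n _ 0))

sign-^2^ : ∀ j {n} → n ≡ 0 ⊎ Odd n → ∃[ u ] n ℕ.^ (2 ℕ.^ j) ≡ sign n ℕ.+ 2 ℕ.^ j ℕ.* 2 ℕ.* u
sign-^2^ j {n} (inj₁ ≡.refl) = 0 , ≡.trans (0^ (2 ℕ.^ j) (ℕ.≤-trans (s≤s z≤n) (n<2^n j))) (≡.sym (ℕ.*-zeroʳ (2 ℕ.^ j ℕ.* 2)))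
  where
  0^ : ∀ k → 0 ℕ.< k → 0 ℕ.^ k ≡ 0
  0^ (suc k) _ = ≡.refl
sign-^2^ j (inj₂ (k , ≡.refl)) = odd^2^ j 1 k

%-unique : ∀ {a b m k l} → a ℕ.< m → b ℕ.< m → a ℕ.+ m ℕ.* k ≡ b ℕ.+ m ℕ.* l → a ≡ b
%-unique {a} {b} {m@(suc _)} {k} {l} a<m b<m eq = begin
  a                     ≡⟨ reduce a<m k ⟨
  (a ℕ.+ m ℕ.* k) % m   ≡⟨ cong (_% m) eq ⟩
  (b ℕ.+ m ℕ.* l) % m   ≡⟨ reduce b<m l ⟩
  b                     ∎
  where
  open ≡.≡-Reasoning
  reduce : ∀ {a} → a ℕ.< m → ∀ k → (a ℕ.+ m ℕ.* k) % m ≡ a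
  reduce {a} a<m k = ≡.trans (cong (λ t → (a ℕ.+ t) % m) (ℕ.*-comm m k)) (≡.trans ([m+kn]%n≡m%n a k m) (m<n⇒m%n≡m a<m))


-- Character sums

-- Nontriviality is expressed by its consequence, the vanishing of the total sum. This is what
-- orthogonality uses, and over a ring with zero divisors it would not follow from a value different
-- from 1.
record IsNontrivialCharacter {c ℓ} (R : CommutativeRing c ℓ) {q : ℕ} (𝔽 : FiniteField q)
                             (χ : FiniteField.Carrier 𝔽 → CommutativeRing.Carrier R) : Set ℓ where
  open CommutativeRing R
  private module K = FiniteField 𝔽
  open FiniteSum +-commutativeMonoid K.enumeration
  field
    χ-0  : χ K.0# ≈ 1#
    χ-+  : ∀ x y → χ (x K.+ y) ≈ χ x * χ y
    ∑χ≈0 : ∑ χ ≈ 0#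

-- Carries identities between character sums back to ℕ, where order and remainders are available.
CharacteristicZero : ∀ {c ℓ} → CommutativeRing c ℓ → Set ℓ
CharacteristicZero R = ∀ m n → m · 1# ≈ n · 1# → m ≡ n
  where
  open CommutativeRing R
  open SemiringMult semiring renaming (_×_ to _·_)

module CharacterSums {c ℓ} (R : CommutativeRing c ℓ) {q : ℕ} (𝔽 : FiniteField q)
                     (χ : FiniteField.Carrier 𝔽 → CommutativeRing.Carrier R)
                     (isCharacter : IsNontrivialCharacter R 𝔽 χ) where
  open CommutativeRing R hiding (zero) renaming (refl to ≈-refl; sym to ≈-sym; trans to ≈-trans)
  open SemiringMult semiring renaming (_×_ to _·_)
  open CommutativeMonoidMult +-commutativeMonoid using (×-distrib-+)
  open SemiringSum semiring using (*-distribˡ-sum; *-distribʳ-sum)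
  open SemiringExp semiring using (_^_; ^-congˡ; ^-assocʳ)
  open IsNontrivialCharacter isCharacter
  open FibreSum 𝔽 +-commutativeMonoid
  module K where
    open FiniteField 𝔽 public
    open CommutativeRing commutativeRing public using (distribˡ; zeroʳ; zeroˡ; +-identityʳ; *-comm; *-assoc; *-identityʳ; -‿inverseʳ; +-group)
  open FiniteSum +-commutativeMonoid K.enumeration
  open import Algebra.Properties.Group K.+-group using (x∙y⁻¹≈ε⇒x≈y; x≈y⇒x∙y⁻¹≈ε; ε⁻¹≈ε)
  module ℕΣ = Fibres 𝔽
  open import Relation.Binary.Reasoning.Setoid setoid
  open IntegerSolver K.commutativeRing using () renaming (solve to solveᴷ; _:=_ to _⊜_; _:+_ to _⊕_; _:*_ to _⊛_; _:-_ to _⊖_; :-_ to ⊝_)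

  Q : Carrier
  Q = q · 1#

  χ-cong : ∀ {x y} → x ≡ y → χ x ≈ χ y
  χ-cong x≡y = reflexive (cong χ x≡y)

  ∑-*ˡ : ∀ k g → k * ∑ g ≈ ∑ (λ x → k * g x)
  ∑-*ˡ k g =
    ≈-trans (*-congˡ (reflexive (∑≡sum g))) (≈-trans (*-distribˡ-sum k (g ∘ K.element)) (reflexive (≡.sym (∑≡sum _))))

  ∑-*ʳ : ∀ k g → ∑ g * k ≈ ∑ (λ x → g x * k)
  ∑-*ʳ k g =
    ≈-trans (*-congʳ (reflexive (∑≡sum g))) (≈-trans (*-distribʳ-sum k (g ∘ K.element)) (reflexive (≡.sym (∑≡sum _))))

  ∑-*-∑ : ∀ g h → ∑ g * ∑ h ≈ ∑ (λ x → ∑ (λ y → g x * h y))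
  ∑-*-∑ g h = ≈-trans (∑-*ʳ (∑ h) g) (∑-cong (λ x → ∑-*ˡ (g x) h))

  ∑-1 : ∑ (λ _ → 1#) ≈ Q
  ∑-1 = ∑-const 1#

  -- Multiplication by `x` permutes the field, so this is the total sum of `χ` in another order.
  ∑-orthogonal : ∀ {x} → x ≢ K.0# → ∑ (λ b → χ (b K.* x)) ≈ 0#
  ∑-orthogonal {x} x≢0 with x⁻¹ , xx⁻¹ ← K.inverse x≢0 =
    ≈-trans (≈-sym (∑-reindex {χ} (K._* x) (K._* x⁻¹)
      (λ b → cancel b x⁻¹ x (≡.trans (K.*-comm x⁻¹ x) xx⁻¹)) (λ b → cancel b x x⁻¹ xx⁻¹))) ∑χ≈0
    where
    cancel : ∀ b x y → x K.* y ≡ K.1# → b K.* x K.* y ≡ b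
    cancel b x y xy≡1 = ≡.trans (K.*-assoc b x y) (≡.trans (cong (b K.*_) xy≡1) (K.*-identityʳ b))

  ∑-δ-character : ∀ x y → ∑ (λ b → χ (b K.* (x K.- y))) ≈ 𝟙 (x K.≟ y) · Q
  ∑-δ-character x y = by-cases (x K.≟ y)
   where
   -- The decision is a variable, so matching on it evaluates `𝟙`.
   by-cases : (x≟y : Dec (x ≡ y)) → ∑ (λ b → χ (b K.* (x K.- y))) ≈ 𝟙 x≟y · Q
   by-cases (yes x≡y) = begin
    ∑ (λ b → χ (b K.* (x K.- y)))
      ≈⟨ ∑-cong (λ b → ≈-trans (χ-cong (≡.trans (cong (b K.*_) (x≈y⇒x∙y⁻¹≈ε x≡y)) (K.zeroʳ b))) χ-0) ⟩
    ∑ (λ b → 1#)                   ≈⟨ ∑-1 ⟩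
    Q                              ≈⟨ +-identityʳ Q ⟨
    1 · Q                          ∎
   by-cases (no x≢y) = ∑-orthogonal (x≢y ∘ x∙y⁻¹≈ε⇒x≈y x y)

  -- Orthogonality detects `g y ≡ v`. It serves twice: with `g = f` and `v = f x` for the energies,
  -- and with a difference map of `f` for planarity.
  ∑-preimages-character : ∀ g v → ∑ (λ b → ∑ (λ y → χ (b K.* (g y K.- v)))) ≈ preimages 𝔽 g v · Q
  ∑-preimages-character g v = begin
    ∑ (λ b → ∑ (λ y → χ (b K.* (g y K.- v))))  ≈⟨ ∑-swap (λ b y → χ (b K.* (g y K.- v))) ⟩
    ∑ (λ y → ∑ (λ b → χ (b K.* (g y K.- v))))  ≈⟨ ∑-cong (λ y → ∑-δ-character (g y) v) ⟩
    ∑ (λ y → 𝟙 (g y K.≟ v) · Q)                ≈⟨ ∑-· (λ y → 𝟙 (g y K.≟ v)) Q ⟩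
    ℕΣ.∑ (λ y → 𝟙 (g y K.≟ v)) · Q             ≈⟨ ×-congˡ (ℕΣ.count≡∑ (λ y → g y K.≟ v)) ⟨
    preimages 𝔽 g v · Q                        ∎

  eval : List K.Carrier → K.Carrier → Carrier
  eval []       b = 0#
  eval (a ∷ as) b = χ (b K.* a) + eval as b

  -- Sums of additive characters, i.e. images of elements of ℕ[𝔽, +] under Fourier transformation.
  Trigonometric : (K.Carrier → Carrier) → Set ℓ
  Trigonometric φ = ∃[ as ] (∀ b → φ b ≈ eval as b)

  eval-++ : ∀ as as′ b → eval (as ++ as′) b ≈ eval as b + eval as′ b
  eval-++ []       as′ b = ≈-sym (+-identityˡ _)
  eval-++ (a ∷ as) as′ b = ≈-trans (+-congˡ (eval-++ as as′ b)) (≈-sym (+-assoc _ _ _))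

  -- A character acts on a sum of characters by translating its frequencies; products of such sums
  -- therefore are again such sums.
  eval-shift : ∀ a as b → eval (map (a K.+_) as) b ≈ χ (b K.* a) * eval as b
  eval-shift a []        b = ≈-sym (zeroʳ _)
  eval-shift a (a′ ∷ as) b = begin
    χ (b K.* (a K.+ a′)) + eval (map (a K.+_) as) b        ≈⟨ +-cong (χ-cong (K.distribˡ b a a′)) (eval-shift a as b) ⟩
    χ (b K.* a K.+ b K.* a′) + χ (b K.* a) * eval as b     ≈⟨ +-congʳ (χ-+ _ _) ⟩
    χ (b K.* a) * χ (b K.* a′) + χ (b K.* a) * eval as b   ≈⟨ distribˡ _ _ _ ⟨
    χ (b K.* a) * eval (a′ ∷ as) b                         ∎

  trig-+ : ∀ {φ ψ} → Trigonometric φ → Trigonometric ψ → Trigonometric (λ b → φ b + ψ b)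
  trig-+ (as , φ≈) (as′ , ψ≈) = as ++ as′ , λ b → ≈-trans (+-cong (φ≈ b) (ψ≈ b)) (≈-sym (eval-++ as as′ b))

  trig-0 : Trigonometric (λ _ → 0#)
  trig-0 = [] , λ _ → ≈-refl

  trig-χ : ∀ a → Trigonometric (λ b → χ (b K.* a))
  trig-χ a = a ∷ [] , λ _ → ≈-sym (+-identityʳ _)

  trig-resp : ∀ {φ ψ} → (∀ b → ψ b ≈ φ b) → Trigonometric φ → Trigonometric ψ
  trig-resp ψ≈φ (as , φ≈) = as , λ b → ≈-trans (ψ≈φ b) (φ≈ b)

  trig-* : ∀ {φ ψ} → Trigonometric φ → Trigonometric ψ → Trigonometric (λ b → φ b * ψ b)
  trig-* {ψ = ψ} (as , φ≈) ψ-trig = trig-resp (λ b → *-congʳ (φ≈ b)) (eval-* as ψ-trig)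
    where
    eval-* : ∀ as → Trigonometric ψ → Trigonometric (λ b → eval as b * ψ b)
    eval-* []       _                 = trig-resp (λ b → zeroˡ _) trig-0
    eval-* (a ∷ as) ψ-trig@(as′ , ψ≈) = trig-resp (λ b → ≈-trans (distribʳ _ _ _)
      (+-congʳ (≈-trans (*-congˡ (ψ≈ b)) (≈-sym (eval-shift a as′ b))))) (trig-+ (map (a K.+_) as′ , λ _ → ≈-refl) (eval-* as ψ-trig))

  trig-· : ∀ n {φ} → Trigonometric φ → Trigonometric (λ b → n · φ b)
  trig-· zero    φ-trig = trig-0
  trig-· (suc n) φ-trig = trig-+ φ-trig (trig-· n φ-trig)

  -- With negation for `σ` this also covers the conjugate sum, so coefficients in ℕ suffice.
  trig-∑ : ∀ (n : K.Carrier → ℕ) (σ : K.Carrier → K.Carrier) → Trigonometric (λ b → ∑ (λ y → n y · χ (b K.* σ y)))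
  trig-∑ n σ = trig-resp (λ b → reflexive (∑≡sum _)) (trig-sum K.element)
    where
    open SemiringSum semiring using (sum)
    trig-sum : ∀ {m} (e : Fin m → K.Carrier) → Trigonometric (λ b → sum (λ i → n (e i) · χ (b K.* σ (e i))))
    trig-sum {zero}  e = trig-0
    trig-sum {suc m} e = trig-+ (trig-· (n (e zero)) (trig-χ (σ (e zero)))) (trig-sum (e ∘ suc))

  -- Only the frequency 0 survives summation over `b`, so `m` counts its occurrences in the list.
  -- This is the source of integrality: information about elements of `R` becomes information about
  -- a natural number.
  ∑-trig : ∀ {φ} → Trigonometric φ → ∃[ m ] ∑ φ ≈ m · Q
  ∑-trig (as , φ≈) = proj₁ (∑-eval as) , ≈-trans (∑-cong φ≈) (proj₂ (∑-eval as))
    where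
    ∑-eval : ∀ as → ∃[ m ] ∑ (eval as) ≈ m · Q
    ∑-eval []       = 0 , ∑-ε (λ _ → ≈-refl)
    ∑-eval (a ∷ as) with m , eq ← ∑-eval as = 𝟙 (a K.≟ K.0#) ℕ.+ m , (begin
      ∑ (eval (a ∷ as))                                            ≈⟨ ∑-∙ _ _ ⟩
      ∑ (λ b → χ (b K.* a)) + ∑ (eval as)
        ≈⟨ +-cong (∑-cong (λ b → χ-cong (cong (b K.*_) (a-0 a)))) eq ⟩
      ∑ (λ b → χ (b K.* (a K.- K.0#))) + m · Q                     ≈⟨ +-congʳ (∑-δ-character a K.0#) ⟩
      𝟙 (a K.≟ K.0#) · Q + m · Q                                   ≈⟨ ×-homo-+ Q (𝟙 (a K.≟ K.0#)) m ⟨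
      (𝟙 (a K.≟ K.0#) ℕ.+ m) · Q                                   ∎)
      where
      a-0 : ∀ a → a ≡ a K.- K.0#
      a-0 a = ≡.sym (≡.trans (cong (a K.+_) ε⁻¹≈ε) (K.+-identityʳ a))

  private
    -- (1 + x)² = 1 + 2x + x² for x = (2m) · t.
    square : ∀ m t → (1# + (2 ℕ.* m) · t) ^ 2 ≈ 1# + (2 ℕ.* (2 ℕ.* m)) · (t + m · (t * t))
    square m t = begin
      (1# + x) * ((1# + x) * 1#)                        ≈⟨ *-congˡ (*-identityʳ _) ⟩
      (1# + x) * (1# + x)                               ≈⟨ distribʳ _ _ _ ⟩
      1# * (1# + x) + x * (1# + x)
        ≈⟨ +-cong (*-identityˡ _) (≈-trans (distribˡ _ _ _) (+-congʳ (*-identityʳ x))) ⟩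
      (1# + x) + (x + x * x)                            ≈⟨ ≈-trans (+-assoc _ _ _) (+-congˡ (≈-sym (+-assoc _ _ _))) ⟩
      1# + ((x + x) + x * x)                            ≈⟨ +-congˡ (+-cong linear quadratic) ⟩
      1# + ((2 ℕ.* n) · t + (2 ℕ.* n) · (m · (t * t)))  ≈⟨ +-congˡ (×-distrib-+ _ _ (2 ℕ.* n)) ⟨
      1# + (2 ℕ.* n) · (t + m · (t * t))                ∎
      where
      n = 2 ℕ.* m
      x = n · t
      linear : x + x ≈ (2 ℕ.* n) · t
      linear = ≈-trans (+-congˡ (≈-sym (+-identityʳ x))) (×-assocˡ t 2 n)
      quadratic : x * x ≈ (2 ℕ.* n) · (m · (t * t))
      quadratic = begin
        (n · t) * (n · t)            ≈⟨ ×-assoc-* n t _ ⟩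
        n · (t * (n · t))            ≈⟨ ×-congʳ n (×-comm-* n t t) ⟩
        n · (n · (t * t))            ≈⟨ ×-assocˡ _ n n ⟩
        (n ℕ.* n) · (t * t)          ≡⟨ cong (_· (t * t)) (n*n m) ⟩
        (2 ℕ.* n ℕ.* m) · (t * t)    ≈⟨ ×-assocˡ _ (2 ℕ.* n) m ⟨
        (2 ℕ.* n) · (m · (t * t))    ∎
        where
        n*n : ∀ m → (2 ℕ.* m) ℕ.* (2 ℕ.* m) ≡ 2 ℕ.* (2 ℕ.* m) ℕ.* m
        n*n = ℕSolver.solve 1 (λ m → (ℕSolver.con 2 ℕSolver.:* m) ℕSolver.:* (ℕSolver.con 2 ℕSolver.:* m)
          ℕSolver.:= ℕSolver.con 2 ℕSolver.:* (ℕSolver.con 2 ℕSolver.:* m) ℕSolver.:* m) ≡.refl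
          where module ℕSolver = +-*-Solver

  -- The squarings of `odd^2^`, carried out in `R` for all `b` at once. The new cofactor `T + m T²`
  -- is again a sum of characters, which keeps the induction going.
  trig-^2^ : ∀ j m {φ T : K.Carrier → Carrier} → (∀ b → φ b ≈ 1# + (2 ℕ.* m) · T b) → Trigonometric T →
             ∃[ U ] Trigonometric U × (∀ b → φ b ^ (2 ℕ.^ j) ≈ 1# + (2 ℕ.^ j ℕ.* (2 ℕ.* m)) · U b)
  trig-^2^ zero m {φ} {T} φ≈ T-trig = T , T-trig , λ b → ≈-trans (*-identityʳ _)
    (≈-trans (φ≈ b) (+-congˡ (×-congˡ {T b} (≡.sym (ℕ.*-identityˡ (2 ℕ.* m))))))
  trig-^2^ (suc j) m {φ} {T} φ≈ T-trig
    with U , U-trig , U≈ ← trig-^2^ j (2 ℕ.* m) {λ b → φ b ^ 2} {λ b → T b + m · (T b * T b)} (λ b → ≈-trans (^-congˡ 2 (φ≈ b)) (square m (T b)))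
                             (trig-+ T-trig (trig-· m (trig-* T-trig T-trig)))
    = U , U-trig , λ b → begin
      φ b ^ (2 ℕ.* 2 ℕ.^ j)                              ≈⟨ ^-assocʳ (φ b) 2 (2 ℕ.^ j) ⟨
      (φ b ^ 2) ^ (2 ℕ.^ j)                              ≈⟨ U≈ b ⟩
      1# + (2 ℕ.^ j ℕ.* (2 ℕ.* (2 ℕ.* m))) · U b         ≡⟨ cong (λ k → 1# + k · U b) (regroup (2 ℕ.^ j)) ⟩
      1# + (2 ℕ.^ (suc j) ℕ.* (2 ℕ.* m)) · U b           ∎
    where
    regroup : ∀ p → p ℕ.* (2 ℕ.* (2 ℕ.* m)) ≡ 2 ℕ.* p ℕ.* (2 ℕ.* m)
    regroup p = ≡.trans (≡.sym (ℕ.*-assoc p 2 (2 ℕ.* m))) (cong (ℕ._* (2 ℕ.* m)) (ℕ.*-comm p 2))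

  module _ (f : K.Carrier → K.Carrier) where

    -- For a character with values on the unit circle, negating the argument is conjugation; in this
    -- form no conjugation on `R` is required.
    W W̄ : K.Carrier → K.Carrier → Carrier
    W b a = ∑ (λ x → χ (b K.* f x K.- a K.* x))
    W̄ b a = ∑ (λ x → χ (K.- (b K.* f x K.- a K.* x)))

    -- The product expands over pairs `x`, `y`, and summation over `b` keeps those with `f x ≡ f y`;
    -- the right side counts them by `x`.
    ∑-energy : ∑ (λ b → W b K.0# * W̄ b K.0#) ≈ ℕΣ.∑ (λ x → preimages 𝔽 f (f x)) · Q
    ∑-energy = begin
      ∑ (λ b → W b K.0# * W̄ b K.0#)                            ≈⟨ ∑-cong expand ⟩
      ∑ (λ b → ∑ (λ x → ∑ (λ y → χ (b K.* (f y K.- f x)))))    ≈⟨ ∑-swap (λ b x → ∑ (λ y → χ (b K.* (f y K.- f x)))) ⟩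
      ∑ (λ x → ∑ (λ b → ∑ (λ y → χ (b K.* (f y K.- f x)))))    ≈⟨ ∑-cong (λ x → ∑-preimages-character f (f x)) ⟩
      ∑ (λ x → preimages 𝔽 f (f x) · Q)                        ≈⟨ ∑-· (λ x → preimages 𝔽 f (f x)) Q ⟩
      ℕΣ.∑ (λ x → preimages 𝔽 f (f x)) · Q                     ∎
      where
      term : ∀ b u v x y → K.- (b K.* u K.- K.0# K.* x) K.+ (b K.* v K.- K.0# K.* y) ≡ b K.* (v K.- u)
      term b u v x y = ≡.trans
        (≡.cong₂ (λ s t → K.- (b K.* u K.- s) K.+ (b K.* v K.- t)) (K.zeroˡ x) (K.zeroˡ y))
        (solveᴷ 3 (λ b u v → ⊝ (b ⊛ u ⊖ con₀) ⊕ (b ⊛ v ⊖ con₀) ⊜ b ⊛ (v ⊖ u)) ≡.refl b u v)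
        where
        open IntegerSolver K.commutativeRing using () renaming (con to conᴷ)
        con₀ = conᴷ {3} 0ℤ
      expand : ∀ b → W b K.0# * W̄ b K.0# ≈ ∑ (λ x → ∑ (λ y → χ (b K.* (f y K.- f x))))
      expand b = ≈-trans (*-comm _ _) (≈-trans (∑-*-∑ _ _) (∑-cong (λ x → ∑-cong (λ y →
        ≈-trans (≈-sym (χ-+ _ _)) (χ-cong (term b (f x) (f y) x y))))))

    -- The Wiener-Khinchin relation: the Fourier transform of the power spectrum is the
    -- autocorrelation. Orthogonality in `c` leaves only `x = y + a`. The shift `a = 0` is
    -- Parseval's identity, the other shifts give the differences that planarity is about.
    ∑-correlation : ∀ b a → ∑ (λ c → W b c * W̄ b c * χ (c K.* a)) ≈ ∑ (λ y → χ (b K.* (f (y K.+ a) K.- f y))) * Q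
    ∑-correlation b a = begin
      ∑ (λ c → W b c * W̄ b c * χ (c K.* a))                             ≈⟨ ∑-cong expand ⟩
      ∑ (λ c → ∑ (λ y → ∑ (λ x → e y x * χ (c K.* (y K.+ a K.- x)))))
        ≈⟨ ∑-swap (λ c y → ∑ (λ x → e y x * χ (c K.* (y K.+ a K.- x)))) ⟩
      ∑ (λ y → ∑ (λ c → ∑ (λ x → e y x * χ (c K.* (y K.+ a K.- x)))))   ≈⟨ ∑-cong inner ⟩
      ∑ (λ y → e y (y K.+ a) * Q)                                       ≈⟨ ∑-*ʳ Q (λ y → e y (y K.+ a)) ⟨
      ∑ (λ y → e y (y K.+ a)) * Q                                       ∎
      where
      e : K.Carrier → K.Carrier → Carrier
      e y x = χ (b K.* (f x K.- f y))
      inner : ∀ y → ∑ (λ c → ∑ (λ x → e y x * χ (c K.* (y K.+ a K.- x)))) ≈ e y (y K.+ a) * Q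
      inner y = begin
        ∑ (λ c → ∑ (λ x → e y x * χ (c K.* (y K.+ a K.- x))))   ≈⟨ ∑-swap (λ c x → e y x * χ (c K.* (y K.+ a K.- x))) ⟩
        ∑ (λ x → ∑ (λ c → e y x * χ (c K.* (y K.+ a K.- x))))
          ≈⟨ ∑-cong (λ x → ∑-*ˡ (e y x) (λ c → χ (c K.* (y K.+ a K.- x)))) ⟨
        ∑ (λ x → e y x * ∑ (λ c → χ (c K.* (y K.+ a K.- x))))   ≈⟨ ∑-cong (λ x → *-congˡ (∑-δ-character (y K.+ a) x)) ⟩
        ∑ (λ x → e y x * (𝟙 (y K.+ a K.≟ x) · Q))               ≈⟨ ∑-cong (λ x → ×-comm-* (𝟙 (y K.+ a K.≟ x)) (e y x) Q) ⟩
        ∑ (λ x → 𝟙 (y K.+ a K.≟ x) · (e y x * Q))               ≈⟨ ∑-δ (λ x → e y x * Q) (y K.+ a) ⟩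
        e y (y K.+ a) * Q                                       ∎
      term : ∀ c u v x y → (K.- (b K.* v K.- c K.* y) K.+ (b K.* u K.- c K.* x)) K.+ c K.* a ≡ b K.* (u K.- v) K.+ c K.* (y K.+ a K.- x)
      term c u v x y = solveᴷ 7 (λ b a c u v x y → (⊝ (b ⊛ v ⊖ c ⊛ y) ⊕ (b ⊛ u ⊖ c ⊛ x)) ⊕ c ⊛ a
        ⊜ b ⊛ (u ⊖ v) ⊕ c ⊛ (y ⊕ a ⊖ x)) ≡.refl b a c u v x y
      expand : ∀ c → W b c * W̄ b c * χ (c K.* a) ≈ ∑ (λ y → ∑ (λ x → e y x * χ (c K.* (y K.+ a K.- x))))
      expand c = ≈-trans (*-congʳ (≈-trans (*-comm _ _) (∑-*-∑ _ _))) (≈-trans (∑-*ʳ _ _) (∑-cong (λ y →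
        ≈-trans (∑-*ʳ _ _) (∑-cong (λ x → ≈-trans (*-congʳ (≈-sym (χ-+ _ _))) (≈-trans (≈-sym (χ-+ _ _))
          (≈-trans (χ-cong (term c (f x) (f y) x y)) (χ-+ _ _))))))))

-- Plateaued 2-to-1 functions are planar

module TwoToOneShape {q} (𝔽 : FiniteField q) (h : ℕ) (q≡1+2h : q ≡ 1 ℕ.+ 2 ℕ.* h)
                     (f : FiniteField.Carrier 𝔽 → FiniteField.Carrier 𝔽) where
  open FiniteField 𝔽 using (Carrier)
  open Fibres 𝔽
  open FibreSum 𝔽 ℕ.+-0-commutativeMonoid using (∑-preimages)
  open +-*-Solver

  private
    h≡ : (q ℕ.∸ 1) / 2 ≡ h
    h≡ = trans (cong (λ n → (n ℕ.∸ 1) / 2) q≡1+2h) (trans (cong (_/ 2) (ℕ.*-comm 2 h)) (m*n/n≡m h 2))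

  one two pre : Carrier → ℕ
  pre = preimages 𝔽 f
  one y = 𝟙 (pre y ℕ.≟ 1)
  two y = 𝟙 (pre y ℕ.≟ 2)

  ∑-pre-* : ∀ (g : Carrier → ℕ) → ∑ (g ∘ f) ≡ ∑ (λ y → pre y ℕ.* g y)
  ∑-pre-* g = trans (∑-preimages f g) (∑-cong (λ y → ·≡* (pre y) (g y)))

  ∑-pre : ∑ pre ≡ q
  ∑-pre =
    trans (∑-cong (λ y → sym (ℕ.*-identityʳ (pre y)))) (trans (sym (∑-pre-* (λ _ → 1))) (trans (∑-const-* 1) (ℕ.*-identityʳ q)))

  -- The left side is `n` for `n ≤ 2` and 0 beyond, so equality says exactly that a fibre has at
  -- most two elements.
  shape≤ : ∀ n → 𝟙 (n ℕ.≟ 1) ℕ.+ (𝟙 (n ℕ.≟ 2) ℕ.+ 𝟙 (n ℕ.≟ 2)) ℕ.≤ n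
  shape≤ 0             = z≤n
  shape≤ 1             = ℕ.≤-refl
  shape≤ 2             = ℕ.≤-refl
  shape≤ (suc (suc (suc n))) = z≤n

  -- The fibres counted by `TwoToOne` contain `1 + 2h = q` points, which is the whole domain, so
  -- nothing is left for a fibre of three or more.
  twoToOne⇒shape : TwoToOne 𝔽 f → ∀ y → one y ℕ.+ (two y ℕ.+ two y) ≡ pre y
  twoToOne⇒shape (#1 , #2) = ∑-≤-≡ (λ y → shape≤ (pre y)) (begin
    ∑ (λ y → one y ℕ.+ (two y ℕ.+ two y))   ≡⟨ ∑-∙ one _ ⟩
    ∑ one ℕ.+ ∑ (λ y → two y ℕ.+ two y)     ≡⟨ cong (∑ one ℕ.+_) (∑-∙ two two) ⟩
    ∑ one ℕ.+ (∑ two ℕ.+ ∑ two)             ≡⟨ cong₂ (λ s t → s ℕ.+ (t ℕ.+ t)) ∑-one ∑-two ⟩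
    1 ℕ.+ (h ℕ.+ h)                         ≡⟨ cong (λ t → 1 ℕ.+ (h ℕ.+ t)) (sym (ℕ.+-identityʳ h)) ⟩
    1 ℕ.+ 2 ℕ.* h                           ≡⟨ q≡1+2h ⟨
    q                                       ≡⟨ ∑-pre ⟨
    ∑ pre                                   ∎)
    where
    open ≡.≡-Reasoning
    ∑-one : ∑ one ≡ 1
    ∑-one = trans (sym (count≡∑ _)) #1
    ∑-two : ∑ two ≡ h
    ∑-two = trans (sym (count≡∑ _)) (trans #2 h≡)

  -- The fibre sizes add up to `q`, so the number of fibres of size 2 follows once the singletons
  -- are counted.
  shape⇒twoToOne : ∑ one ≡ 1 → (∀ y → one y ℕ.+ (two y ℕ.+ two y) ≡ pre y) → TwoToOne 𝔽 f
  shape⇒twoToOne ∑-one shape = trans (count≡∑ _) ∑-one , trans (count≡∑ _) (trans ∑-two (sym h≡))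
    where
    open ≡.≡-Reasoning
    ∑-two : ∑ two ≡ h
    ∑-two = ℕ.*-cancelˡ-≡ (∑ two) h 2 (ℕ.suc-injective (begin
      1 ℕ.+ 2 ℕ.* ∑ two                       ≡⟨ cong₂ (λ s t → s ℕ.+ (∑ two ℕ.+ t)) (sym ∑-one) (ℕ.+-identityʳ (∑ two)) ⟩
      ∑ one ℕ.+ (∑ two ℕ.+ ∑ two)             ≡⟨ cong (∑ one ℕ.+_) (∑-∙ two two) ⟨
      ∑ one ℕ.+ ∑ (λ y → two y ℕ.+ two y)     ≡⟨ ∑-∙ one _ ⟨
      ∑ (λ y → one y ℕ.+ (two y ℕ.+ two y))   ≡⟨ ∑-cong shape ⟩
      ∑ pre                                   ≡⟨ ∑-pre ⟩
      q                                       ≡⟨ q≡1+2h ⟩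
      1 ℕ.+ 2 ℕ.* h                           ∎))

  twoToOne⇒∑-one : TwoToOne 𝔽 f → ∑ one ≡ 1
  twoToOne⇒∑-one (#1 , _) = trans (sym (count≡∑ _)) #1

  -- The number of pairs with equal values is `2q - 1`, written without subtraction. It rests on
  -- `n² + 𝟙 (n ≟ 1) = 2n` for each fibre size `n ≤ 2`.
  twoToOne⇒∑-pre∘f : TwoToOne 𝔽 f → ∑ (pre ∘ f) ℕ.+ 1 ≡ q ℕ.+ q
  twoToOne⇒∑-pre∘f tto = begin
    ∑ (pre ∘ f) ℕ.+ 1                                ≡⟨ cong₂ ℕ._+_ (∑-pre-* pre) (sym (twoToOne⇒∑-one tto)) ⟩
    ∑ (λ y → pre y ℕ.* pre y) ℕ.+ ∑ one              ≡⟨ ∑-∙ _ one ⟨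
    ∑ (λ y → pre y ℕ.* pre y ℕ.+ one y)              ≡⟨ ∑-cong (λ y → square (pre y) (twoToOne⇒shape tto y)) ⟩
    ∑ (λ y → pre y ℕ.+ pre y)                        ≡⟨ ∑-∙ pre pre ⟩
    ∑ pre ℕ.+ ∑ pre                                  ≡⟨ cong₂ ℕ._+_ ∑-pre ∑-pre ⟩
    q ℕ.+ q                                          ∎
    where
    open ≡.≡-Reasoning
    square : ∀ n → 𝟙 (n ℕ.≟ 1) ℕ.+ (𝟙 (n ℕ.≟ 2) ℕ.+ 𝟙 (n ℕ.≟ 2)) ≡ n → n ℕ.* n ℕ.+ 𝟙 (n ℕ.≟ 1) ≡ n ℕ.+ n
    square 0 _ = refl
    square 1 _ = refl
    square 2 _ = refl
    square (suc (suc (suc n))) ()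

-- The comparison is between `q`, raised by `q²` at 0, and `n`, raised by `q` at 0. The corrections
-- make both sides agree at 0 and both totals equal `2q²`, so the termwise inequality is an equality
-- and no sum over the nonzero elements alone is needed.
minimal-energy : ∀ {q} (𝔽 : FiniteField q) → let open FiniteField 𝔽; open Fibres 𝔽 in
  (n : Carrier → ℕ) → n 0# ≡ q ℕ.* q → (∀ {b} → b ≢ 0# → q ℕ.≤ n b) → ∑ n ℕ.+ q ≡ (q ℕ.+ q) ℕ.* q →
  ∀ {b} → b ≢ 0# → n b ≡ q
minimal-energy {q} 𝔽 n n-0 n≥q ∑-n {b} b≢0 = begin
  n b                           ≡⟨ ℕ.+-identityʳ (n b) ⟨
  n b ℕ.+ 0                     ≡⟨ cong (λ t → n b ℕ.+ t ·ℕ q) (δ-no b≢0) ⟨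
  n b ℕ.+ δ b ·ℕ q              ≡⟨ ∑-≤-≡ bound total b ⟨
  q ℕ.+ δ b ·ℕ (q ℕ.* q)        ≡⟨ cong (λ t → q ℕ.+ t ·ℕ (q ℕ.* q)) (δ-no b≢0) ⟩
  q ℕ.+ 0                       ≡⟨ ℕ.+-identityʳ q ⟩
  q                             ∎
  where
  open FiniteField 𝔽 using (Carrier; 0#; _≟_)
  open Fibres 𝔽
  open ≡.≡-Reasoning
  δ : Carrier → ℕ
  δ b = 𝟙 (0# ≟ b)
  δ-no : ∀ {b} → b ≢ 0# → δ b ≡ 0
  δ-no {b} b≢0 = 𝟙-no (0# ≟ b) (b≢0 ∘ sym)
  ∑-δℕ : ∀ x → ∑ (λ b → δ b ·ℕ x) ≡ x
  ∑-δℕ x = FibreSum.∑-δ 𝔽 ℕ.+-0-commutativeMonoid (λ _ → x) 0#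
  total : ∑ (λ b → q ℕ.+ δ b ·ℕ (q ℕ.* q)) ≡ ∑ (λ b → n b ℕ.+ δ b ·ℕ q)
  total = begin
    ∑ (λ b → q ℕ.+ δ b ·ℕ (q ℕ.* q))                ≡⟨ ∑-∙ _ _ ⟩
    ∑ (λ _ → q) ℕ.+ ∑ (λ b → δ b ·ℕ (q ℕ.* q))      ≡⟨ cong₂ ℕ._+_ (∑-const-* q) (∑-δℕ (q ℕ.* q)) ⟩
    q ℕ.* q ℕ.+ q ℕ.* q                             ≡⟨ ℕ.*-distribʳ-+ q q q ⟨
    (q ℕ.+ q) ℕ.* q                                 ≡⟨ ∑-n ⟨
    ∑ n ℕ.+ q                                       ≡⟨ cong (∑ n ℕ.+_) (∑-δℕ q) ⟨
    ∑ n ℕ.+ ∑ (λ b → δ b ·ℕ q)                      ≡⟨ ∑-∙ _ _ ⟨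
    ∑ (λ b → n b ℕ.+ δ b ·ℕ q)                      ∎
  bound : ∀ b → q ℕ.+ δ b ·ℕ (q ℕ.* q) ℕ.≤ n b ℕ.+ δ b ·ℕ q
  bound b = by-cases (0# ≟ b)
    where
    by-cases : (0≟b : Dec (0# ≡ b)) → q ℕ.+ 𝟙 0≟b ·ℕ (q ℕ.* q) ℕ.≤ n b ℕ.+ 𝟙 0≟b ·ℕ q
    by-cases (yes 0≡b) = ℕ.≤-reflexive (trans (ℕ.+-comm q _)
      (cong₂ ℕ._+_ (trans (ℕ.+-identityʳ (q ℕ.* q)) (trans (sym n-0) (cong n 0≡b))) (sym (ℕ.+-identityʳ q))))
    by-cases (no 0≢b) = ℕ.+-monoˡ-≤ 0 (n≥q (0≢b ∘ sym))

module PlateauedTwoToOne {c ℓ} (R : CommutativeRing c ℓ) (char0 : CharacteristicZero R)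
  {q : ℕ} (𝔽 : FiniteField q) (h : ℕ) (q≡1+2h : q ≡ 1 ℕ.+ 2 ℕ.* h)
  (χ : FiniteField.Carrier 𝔽 → CommutativeRing.Carrier R) (isCharacter : IsNontrivialCharacter R 𝔽 χ)
  (f : FiniteField.Carrier 𝔽 → FiniteField.Carrier 𝔽) where

  open CommutativeRing R hiding (zero) renaming (refl to ≈-refl; sym to ≈-sym; trans to ≈-trans)
  open SemiringMult semiring renaming (_×_ to _·_)
  open SemiringExp semiring using (_^_; ^-congˡ)
  open CharacterSums R 𝔽 χ isCharacter using (module K; module ℕΣ; χ-cong; Q; ∑-*ˡ; ∑-*ʳ; ∑-1; ∑-orthogonal; ∑-preimages-character;
    Trigonometric; trig-+; trig-χ; trig-*; trig-∑; ∑-trig; trig-^2^; W; W̄; ∑-energy; ∑-correlation)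
  open IsNontrivialCharacter isCharacter
  open FiniteSum +-commutativeMonoid K.enumeration
  open FibreSum 𝔽 +-commutativeMonoid using (∑-·; ∑-preimages)
  open TwoToOneShape 𝔽 h q≡1+2h f
  open IntegerSolver K.commutativeRing using () renaming (solve to solveᴷ; _:=_ to _⊜_; _:+_ to _⊕_; _:*_ to _⊛_; _:-_ to _⊖_; :-_ to ⊝_)
  open import Relation.Binary.Reasoning.Setoid setoid

  -- L stands for p^(n + s_b), and W̄ for the complex conjugate of W.
  PlateauedSquares : Set _
  PlateauedSquares = ∀ b → b ≢ K.0# → ∃[ L ] (Odd L × q ℕ.≤ L) ×
    (∀ a → (W f b a * W̄ f b a ≈ 0#) ⊎ (W f b a * W̄ f b a ≈ L · 1#))

  ∑-·1 : ∀ (n : K.Carrier → ℕ) → ∑ (λ y → n y · 1#) ≈ ℕΣ.∑ n · 1#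
  ∑-·1 n = ∑-· n 1#

  ·1-^ : ∀ n k → (n · 1#) ^ k ≈ (n ℕ.^ k) · 1#
  ·1-^ n zero    = ≈-sym (+-identityʳ 1#)
  ·1-^ n (suc k) = ≈-trans (*-congˡ (·1-^ n k)) (≈-sym (×1-homo-* n (n ℕ.^ k)))

  module _ (tto : TwoToOne 𝔽 f) where

    single-fibre : ∃! _≡_ (λ y → pre y ≡ 1)
    single-fibre = ℕΣ.count≡1⇒∃! (λ y → pre y ℕ.≟ 1) (proj₁ tto)

    y₀ : K.Carrier
    y₀ = proj₁ single-fibre

    -- Each two-element fibre contributes its value twice; these two equal sums are the origin of
    -- the factor 2 in the energies.
    ∑-∘f : ∀ (g : K.Carrier → Carrier) → ∑ (g ∘ f) ≈ g y₀ + (∑ (λ y → two y · g y) + ∑ (λ y → two y · g y))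
    ∑-∘f g = begin
      ∑ (g ∘ f)                                                         ≈⟨ ∑-preimages f g ⟩
      ∑ (λ y → pre y · g y)                                             ≈⟨ ∑-cong (λ y → split y) ⟩
      ∑ (λ y → one y · g y + (two y · g y + two y · g y))               ≈⟨ ≈-trans (∑-∙ _ _) (+-congˡ (∑-∙ _ _)) ⟩
      ∑ (λ y → one y · g y) + (∑ (λ y → two y · g y) + ∑ (λ y → two y · g y))   ≈⟨ +-congʳ single ⟩
      g y₀ + (∑ (λ y → two y · g y) + ∑ (λ y → two y · g y))            ∎
      where
      split : ∀ y → pre y · g y ≈ one y · g y + (two y · g y + two y · g y)
      split y = ≈-trans (×-congˡ {g y} (sym (twoToOne⇒shape tto y)))
        (≈-trans (×-homo-+ (g y) (one y) _) (+-congˡ (×-homo-+ (g y) (two y) (two y))))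
      single : ∑ (λ y → one y · g y) ≈ g y₀
      single = ≈-trans
        (∑-single y₀ (λ y y≢y₀ → ×-congˡ {g y} (𝟙-no (pre y ℕ.≟ 1) (λ pre≡1 → y≢y₀ (sym (proj₂ (proj₂ single-fibre) pre≡1))))))
        (≈-trans (×-congˡ {g y₀} (𝟙-yes (pre y₀ ℕ.≟ 1) (proj₁ (proj₂ single-fibre)))) (+-identityʳ _))

    W-b-0 : ∀ b → W f b K.0# ≈ ∑ (λ x → χ (b K.* f x))
    W-b-0 b = ∑-cong (λ x → χ-cong (term x (f x)))
      where
      open IntegerSolver K.commutativeRing using () renaming (con to conᴷ)
      term : ∀ x u → b K.* u K.- K.0# K.* x ≡ b K.* u
      term x u = solveᴷ 3 (λ b u x → b ⊛ u ⊖ conᴷ 0ℤ ⊛ x ⊜ b ⊛ u) refl b u x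

    W̄-b-0 : ∀ b → W̄ f b K.0# ≈ ∑ (λ x → χ (b K.* (K.- f x)))
    W̄-b-0 b = ∑-cong (λ x → χ-cong (term x (f x)))
      where
      open IntegerSolver K.commutativeRing using () renaming (con to conᴷ)
      term : ∀ x u → K.- (b K.* u K.- K.0# K.* x) ≡ b K.* (K.- u)
      term x u = solveᴷ 3 (λ b u x → ⊝ (b ⊛ u ⊖ conᴷ 0ℤ ⊛ x) ⊜ b ⊛ (⊝ u)) refl b u x

    -- In the product of the two sums given by `∑-∘f`, every term except `e * ē` occurs an even
    -- number of times, and `e * ē` is 1 because the two frequencies are opposite. The factor
    -- `2 ℕ.* 1` is the shape that `trig-^2^` expects for `m = 1`.
    energy-odd : ∃[ S ] Trigonometric S × (∀ b → W f b K.0# * W̄ f b K.0# ≈ 1# + (2 ℕ.* 1) · S b)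
    energy-odd = (λ b → (e b * T̄ b + T b * ē b) + (T b * T̄ b + T b * T̄ b)) ,
      trig-+ (trig-+ (trig-* e-trig T̄-trig) (trig-* T-trig ē-trig)) (trig-+ (trig-* T-trig T̄-trig) (trig-* T-trig T̄-trig)) , λ b → begin
        W f b K.0# * W̄ f b K.0#
          ≈⟨ *-cong (≈-trans (W-b-0 b) (∑-∘f _)) (≈-trans (W̄-b-0 b) (∑-∘f _)) ⟩
        (e b + (T b + T b)) * (ē b + (T̄ b + T̄ b))            ≈⟨ solve 4 (λ e ē T T̄ → (e :+ (T :+ T)) :* (ē :+ (T̄ :+ T̄))
                                                                 := e :* ē :+ (((e :* T̄ :+ T :* ē) :+ (T :* T̄ :+ T :* T̄)) :+ ((e :* T̄ :+ T :* ē) :+ (T :* T̄ :+ T :* T̄))))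
                                                                 ≈-refl (e b) (ē b) (T b) (T̄ b) ⟩
        e b * ē b + (S b + S b)                              ≈⟨ +-cong (eē b) (+-congˡ (≈-sym (+-identityʳ (S b)))) ⟩
        1# + (2 ℕ.* 1) · S b                                 ∎
      where
      open IntegerSolver R using (solve; _:=_; _:+_; _:*_)
      e ē T T̄ S : K.Carrier → Carrier
      e b = χ (b K.* y₀)
      ē b = χ (b K.* (K.- y₀))
      T b = ∑ (λ y → two y · χ (b K.* y))
      T̄ b = ∑ (λ y → two y · χ (b K.* (K.- y)))
      S b = (e b * T̄ b + T b * ē b) + (T b * T̄ b + T b * T̄ b)
      e-trig : Trigonometric e
      e-trig = trig-χ y₀
      ē-trig : Trigonometric ē
      ē-trig = trig-χ (K.- y₀)
      T-trig : Trigonometric T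
      T-trig = trig-∑ two (λ y → y)
      T̄-trig : Trigonometric T̄
      T̄-trig = trig-∑ two (λ y → K.- y)
      eē : ∀ b → e b * ē b ≈ 1#
      eē b = ≈-trans (≈-sym (χ-+ _ _)) (≈-trans (χ-cong (≡.trans (≡.sym (K.distribˡ b y₀ (K.- y₀)))
        (≡.trans (cong (b K.*_) (K.-‿inverseʳ y₀)) (K.zeroʳ b)))) χ-0)

    module _ (plateau : PlateauedSquares) where

      -- All properties are stated for one chosen natural number. Outside 0 it is either 0 or the
      -- plateau value `L`; at 0 every summand is 1, which gives `q * q`, odd because `q` is.
      energy : ∀ b → ∃[ n ] (W f b K.0# * W̄ f b K.0# ≈ n · 1#) × (n ≡ 0 ⊎ Odd n) ×
               (b ≡ K.0# → n ≡ q ℕ.* q) × (b ≢ K.0# → n ≡ 0 ⊎ q ℕ.≤ n)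
      energy b with b K.≟ K.0#
      ... | yes b≡0 =
        q ℕ.* q , ≈-trans (*-cong W≈Q W̄≈Q) (≈-sym (×1-homo-* q q)) , inj₂ q²-odd , (λ _ → refl) , contradiction b≡0
        where
        0*≈1 : ∀ x → χ (b K.* x) ≈ 1#
        0*≈1 x = ≈-trans (χ-cong (≡.trans (cong (K._* x) b≡0) (K.zeroˡ x))) χ-0
        W≈Q : W f b K.0# ≈ Q
        W≈Q = ≈-trans (W-b-0 b) (≈-trans (∑-cong (λ x → 0*≈1 (f x))) ∑-1)
        W̄≈Q : W̄ f b K.0# ≈ Q
        W̄≈Q = ≈-trans (W̄-b-0 b) (≈-trans (∑-cong (λ x → 0*≈1 (K.- f x))) ∑-1)
        q²-odd : Odd (q ℕ.* q)
        q²-odd = 2 ℕ.* h ℕ.+ 2 ℕ.* h ℕ.* h , trans (cong (λ n → n ℕ.* n) q≡1+2h)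
          (solve 1 (λ h → (con 1 :+ con 2 :* h) :* (con 1 :+ con 2 :* h) := con 1 :+ con 2 :* (con 2 :* h :+ con 2 :* h :* h)) refl h)
          where open +-*-Solver
      ... | no b≢0 with L , (L-odd , q≤L) , values ← plateau b b≢0 with values K.0#
      ...   | inj₁ ≈0 = 0 , ≈0 , inj₁ refl , (λ b≡0 → contradiction b≡0 b≢0) , λ _ → inj₁ refl
      ...   | inj₂ ≈L = L , ≈L , inj₂ L-odd , (λ b≡0 → contradiction b≡0 b≢0) , λ _ → inj₂ q≤L

      n : K.Carrier → ℕ
      n b = proj₁ (energy b)

      n-≈ : ∀ b → W f b K.0# * W̄ f b K.0# ≈ n b · 1#
      n-≈ b = proj₁ (proj₂ (energy b))

      n-0⊎odd : ∀ b → n b ≡ 0 ⊎ Odd (n b)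
      n-0⊎odd b = proj₁ (proj₂ (proj₂ (energy b)))

      -- The energies are 1 + 2S with S a sum of characters, so the sum of their 2^j-th powers is q modulo 2^(j+1) q;
      -- on the other hand it is the number of nonzero energies modulo 2^(j+1).
      n≢0 : ∀ b → n b ≢ 0
      n≢0 b nb≡0 = ℕ.1+n≢0 (trans (sym (ℕΣ.∑-≤-≡ (λ b → sign≤1 (n b)) ∑-sign b)) (cong sign nb≡0))
        where
        -- The exponent `q` is chosen only for size: `M = 2 ^ (q + 1)` exceeds `q`, so a count that
        -- is at most `q` can be read off modulo `M`.
        M = 2 ℕ.^ q ℕ.* 2
        power : ∀ b → ∃[ u ] n b ℕ.^ (2 ℕ.^ q) ≡ sign (n b) ℕ.+ M ℕ.* u
        power b = sign-^2^ q (n-0⊎odd b)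
        expansion = trig-^2^ q 1 (proj₂ (proj₂ energy-odd)) (proj₁ (proj₂ energy-odd))
        U = proj₁ expansion
        integral = ∑-trig (proj₁ (proj₂ expansion))
        ∑-power : ℕΣ.∑ (λ b → n b ℕ.^ (2 ℕ.^ q)) ≡ q ℕ.+ M ℕ.* (proj₁ integral ℕ.* q)
        ∑-power = char0 _ _ (begin
          ℕΣ.∑ (λ b → n b ℕ.^ (2 ℕ.^ q)) · 1#                        ≈⟨ ∑-·1 _ ⟨
          ∑ (λ b → (n b ℕ.^ (2 ℕ.^ q)) · 1#)                         ≈⟨ ∑-cong (λ b → ·1-^ (n b) (2 ℕ.^ q)) ⟨
          ∑ (λ b → (n b · 1#) ^ (2 ℕ.^ q))                           ≈⟨ ∑-cong (λ b → ^-congˡ (2 ℕ.^ q) (n-≈ b)) ⟨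
          ∑ (λ b → (W f b K.0# * W̄ f b K.0#) ^ (2 ℕ.^ q))            ≈⟨ ∑-cong (proj₂ (proj₂ expansion)) ⟩
          ∑ (λ b → 1# + M · U b)                                     ≈⟨ ∑-∙ _ _ ⟩
          ∑ (λ b → 1#) + ∑ (λ b → M · U b)                           ≈⟨ +-cong ∑-1 (∑-const-· M U) ⟩
          Q + M · ∑ U                                                ≈⟨ +-congˡ (×-congʳ M (proj₂ integral)) ⟩
          Q + M · (proj₁ integral · Q)
            ≈⟨ +-congˡ (×-congʳ M (×-assocˡ 1# (proj₁ integral) q)) ⟩
          Q + M · ((proj₁ integral ℕ.* q) · 1#)                      ≈⟨ +-congˡ (×-assocˡ 1# M _) ⟩
          Q + (M ℕ.* (proj₁ integral ℕ.* q)) · 1#                    ≈⟨ ×-homo-+ 1# q _ ⟨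
          (q ℕ.+ M ℕ.* (proj₁ integral ℕ.* q)) · 1#                  ∎)
          where
          ∑-const-· : ∀ m g → ∑ (λ b → m · g b) ≈ m · ∑ g
          ∑-const-· zero    g = ∑-ε (λ _ → ≈-refl)
          ∑-const-· (suc m) g = ≈-trans (∑-∙ g (λ b → m · g b)) (+-congˡ (∑-const-· m g))
        q<M : q ℕ.< M
        q<M = ℕ.<-≤-trans (n<2^n q) (ℕ.m≤m*n (2 ℕ.^ q) 2)
        ∑-sign≤q : ℕΣ.∑ (sign ∘ n) ℕ.≤ q
        ∑-sign≤q = ℕ.≤-trans (ℕΣ.∑-mono-≤ (sign≤1 ∘ n)) (ℕ.≤-reflexive (trans (ℕΣ.∑-const-* 1) (ℕ.*-identityʳ q)))
        ∑-sign : ℕΣ.∑ (sign ∘ n) ≡ ℕΣ.∑ (λ _ → 1)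
        ∑-sign = trans (%-unique (ℕ.≤-<-trans ∑-sign≤q q<M) q<M (trans (sym split) ∑-power))
                       (sym (trans (ℕΣ.∑-const-* 1) (ℕ.*-identityʳ q)))
          where
          split : ℕΣ.∑ (λ b → n b ℕ.^ (2 ℕ.^ q)) ≡ ℕΣ.∑ (sign ∘ n) ℕ.+ M ℕ.* ℕΣ.∑ (proj₁ ∘ power)
          split =
            trans (ℕΣ.∑-cong (proj₂ ∘ power)) (trans (ℕΣ.∑-∙ _ _) (cong (ℕΣ.∑ (sign ∘ n) ℕ.+_) (sym (∑ℕ-*ˡ M (proj₁ ∘ power)))))
            where
            ∑ℕ-*ˡ : ∀ k g → k ℕ.* ℕΣ.∑ g ≡ ℕΣ.∑ (λ x → k ℕ.* g x)
            ∑ℕ-*ˡ k g =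
              trans (cong (k ℕ.*_) (ℕΣ.∑≡sum g)) (trans (SemiringSum.*-distribˡ-sum ℕ.+-*-semiring k (g ∘ K.element)) (sym (ℕΣ.∑≡sum _)))

      n-0 : n K.0# ≡ q ℕ.* q
      n-0 = proj₁ (proj₂ (proj₂ (proj₂ (energy K.0#)))) refl

      n≥q : ∀ {b} → b ≢ K.0# → q ℕ.≤ n b
      n≥q {b} b≢0 with proj₂ (proj₂ (proj₂ (proj₂ (energy b)))) b≢0
      ... | inj₁ nb≡0 = contradiction nb≡0 (n≢0 b)
      ... | inj₂ q≤nb = q≤nb

      ∑-n : ℕΣ.∑ n ℕ.+ q ≡ (q ℕ.+ q) ℕ.* q
      ∑-n = trans (cong₂ ℕ._+_ ∑n≡ (sym (ℕ.*-identityˡ q)))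
                  (trans (sym (ℕ.*-distribʳ-+ q P 1)) (cong (ℕ._* q) (twoToOne⇒∑-pre∘f tto)))
        where
        P = ℕΣ.∑ (pre ∘ f)
        ∑n≡ : ℕΣ.∑ n ≡ P ℕ.* q
        ∑n≡ = char0 _ _ (begin
          ℕΣ.∑ n · 1#                               ≈⟨ ∑-·1 n ⟨
          ∑ (λ b → n b · 1#)                        ≈⟨ ∑-cong n-≈ ⟨
          ∑ (λ b → W f b K.0# * W̄ f b K.0#)         ≈⟨ ∑-energy f ⟩
          P · Q                                     ≈⟨ ×-assocˡ 1# P q ⟩
          (P ℕ.* q) · 1#                            ∎)

      n≡q : ∀ {b} → b ≢ K.0# → n b ≡ q
      n≡q = minimal-energy 𝔽 n n-0 n≥q ∑-n

      flat : ∀ {b} → b ≢ K.0# → ∀ a → W f b a * W̄ f b a ≈ Q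
      flat {b} b≢0 a = ≈-trans (proj₁ (proj₂ (level a))) (×-congˡ {1#} (ℕΣ.∑-≤-≡ (λ a → proj₂ (proj₂ (level a))) ∑-level a))
        where
        q≢0 : q ≢ 0
        q≢0 q≡0 = ℕ.1+n≢0 (trans (sym q≡1+2h) q≡0)
        level : ∀ a → ∃[ m ] (W f b a * W̄ f b a ≈ m · 1#) × m ℕ.≤ q
        -- The energy at `0#` is already known to be `q`. This rules out the zero value there and
        -- identifies `L` with `q` for the whole row `b`.
        level a with L , _ , values ← plateau b b≢0 with values K.0#
        ... | inj₁ ≈0 = contradiction (trans (sym (n≡q b≢0)) (char0 (n b) 0 (≈-trans (≈-sym (n-≈ b)) ≈0))) q≢0
        ... | inj₂ ≈L with values a
        ...   | inj₁ ≈0  = 0 , ≈0 , z≤n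
        ...   | inj₂ ≈L′ = L , ≈L′ , ℕ.≤-reflexive (trans (char0 L (n b) (≈-trans (≈-sym ≈L) (n-≈ b))) (n≡q b≢0))
        -- Parseval: the levels are at most `q` and have mean `q`. The factor `χ (c * 0)` is
        -- inserted to present the sum as a correlation with shift 0.
        ∑-level : ℕΣ.∑ (proj₁ ∘ level) ≡ ℕΣ.∑ (λ _ → q)
        ∑-level = trans (char0 _ _ (begin
          ℕΣ.∑ (proj₁ ∘ level) · 1#                                   ≈⟨ ∑-·1 (proj₁ ∘ level) ⟨
          ∑ (λ c → proj₁ (level c) · 1#)                              ≈⟨ ∑-cong (λ c → proj₁ (proj₂ (level c))) ⟨
          ∑ (λ c → W f b c * W̄ f b c)
            ≈⟨ ∑-cong (λ c → ≈-trans (*-congˡ (χ*0 c)) (*-identityʳ _)) ⟨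
          ∑ (λ c → W f b c * W̄ f b c * χ (c K.* K.0#))                ≈⟨ ∑-correlation f b K.0# ⟩
          ∑ (λ y → χ (b K.* (f (y K.+ K.0#) K.- f y))) * Q            ≈⟨ *-congʳ (≈-trans (∑-cong difference≈1) ∑-1) ⟩
          Q * Q                                                       ≈⟨ ×1-homo-* q q ⟨
          (q ℕ.* q) · 1#                                              ∎)) (sym (ℕΣ.∑-const-* q))
          where
          χ*0 : ∀ c → χ (c K.* K.0#) ≈ 1#
          χ*0 c = ≈-trans (χ-cong (K.zeroʳ c)) χ-0
          difference≈1 : ∀ y → χ (b K.* (f (y K.+ K.0#) K.- f y)) ≈ 1#
          difference≈1 y = ≈-trans (χ-cong (cong (b K.*_)
            (≡.trans (cong (λ t → f t K.- f y) (K.+-identityʳ y)) (K.-‿inverseʳ (f y))))) (χ*0 b)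

      -- `D` collects the Fourier coefficients of the value distribution of `g`. By flatness only
      -- `D 0` contributes to the inversion formula, so `g` takes every value equally often, that is
      -- once.
      planar : Planar 𝔽 f
      planar a a≢0 v = ℕΣ.count≡1⇒∃! (λ x → g x K.≟ v) (ℕ.*-cancelʳ-≡ N 1 (q ℕ.* q) N*q²)
        where
        instance
          q²-nonZero : ℕ.NonZero (q ℕ.* q)
          q²-nonZero = ℕ.≢-nonZero (λ q²≡0 → n≢0 K.0# (trans n-0 q²≡0))
        g : K.Carrier → K.Carrier
        g x = f (x K.+ a) K.- f x
        N = preimages 𝔽 g v
        D : K.Carrier → Carrier
        D b = ∑ (λ y → χ (b K.* g y))
        ∑-D : ∑ (λ b → D b * χ (b K.* (K.- v))) ≈ N · Q
        ∑-D = ≈-trans (∑-cong (λ b → ≈-trans (∑-*ʳ _ _) (∑-cong (λ y → ≈-trans (≈-sym (χ-+ _ _))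
          (χ-cong (≡.sym (K.distribˡ b (g y) (K.- v)))))))) (∑-preimages-character g v)
        D≈0 : ∀ {b} → b ≢ K.0# → D b * Q ≈ 0#
        D≈0 {b} b≢0 = begin
          D b * Q                                            ≈⟨ ∑-correlation f b a ⟨
          ∑ (λ c → W f b c * W̄ f b c * χ (c K.* a))          ≈⟨ ∑-cong (λ c → *-congʳ (flat b≢0 c)) ⟩
          ∑ (λ c → Q * χ (c K.* a))                          ≈⟨ ∑-*ˡ Q _ ⟨
          Q * ∑ (λ c → χ (c K.* a))                          ≈⟨ *-congˡ (∑-orthogonal a≢0) ⟩
          Q * 0#                                             ≈⟨ zeroʳ Q ⟩
          0#                                                 ∎
        0*≈1 : ∀ x → χ (K.0# K.* x) ≈ 1#
        0*≈1 x = ≈-trans (χ-cong (K.zeroˡ x)) χ-0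
        -- `R` has no cancellation law, so what is known for `b ≠ 0` is that `D b * Q` vanishes.
        -- Hence the additional factor `Q`, which is cancelled in ℕ at the end.
        N*q² : N ℕ.* (q ℕ.* q) ≡ 1 ℕ.* (q ℕ.* q)
        N*q² = trans (char0 _ _ (begin
          (N ℕ.* (q ℕ.* q)) · 1#                             ≈⟨ ×-assocˡ 1# N (q ℕ.* q) ⟨
          N · ((q ℕ.* q) · 1#)                               ≈⟨ ×-congʳ N (×1-homo-* q q) ⟩
          N · (Q * Q)                                        ≈⟨ ×-assoc-* N Q Q ⟨
          (N · Q) * Q                                        ≈⟨ *-congʳ ∑-D ⟨
          ∑ (λ b → D b * χ (b K.* (K.- v))) * Q              ≈⟨ ∑-*ʳ Q _ ⟩
          ∑ (λ b → D b * χ (b K.* (K.- v)) * Q)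
            ≈⟨ ∑-single K.0# (λ b b≢0 → ≈-trans (*-assoc _ _ _) (≈-trans (*-congˡ (*-comm _ _))
                                                               (≈-trans (≈-sym (*-assoc _ _ _)) (≈-trans (*-congʳ (D≈0 b≢0)) (zeroˡ _))))) ⟩
          D K.0# * χ (K.0# K.* (K.- v)) * Q
            ≈⟨ *-congʳ (*-cong (≈-trans (∑-cong (λ y → 0*≈1 (g y))) ∑-1) (0*≈1 (K.- v))) ⟩
          Q * 1# * Q                                         ≈⟨ *-congʳ (*-identityʳ Q) ⟩
          Q * Q                                              ≈⟨ ×1-homo-* q q ⟨
          (q ℕ.* q) · 1#                                     ∎)) (sym (ℕ.*-identityˡ (q ℕ.* q)))

-- Finite fields and the trace

module _ {p} (p-prime : Prime p) where
  open import Data.Nat.Properties using (_!*_!≢0)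

  prime∤! : ∀ {k} → k ℕ.< p → ¬ p ∣ k !
  prime∤! {zero}  0<p p∣1 = ℕ.<⇒≱ (ℕ.nonTrivial⇒n>1 p {{prime⇒nonTrivial p-prime}}) (∣⇒≤ p∣1)
  prime∤! {suc k} k<p p∣k! with euclidsLemma (suc k) (k !) p-prime p∣k!
  ... | inj₁ p∣1+k = ℕ.<⇒≱ k<p (∣⇒≤ p∣1+k)
  ... | inj₂ p∣k!  = prime∤! (ℕ.<-trans (ℕ.n<1+n k) k<p) p∣k!

  -- `p` divides `p !`, which is the coefficient times `k ! * (p ∸ k) !`, and both of these
  -- factorials have only factors below `p`.
  prime∣C : ∀ {k} → 0 ℕ.< k → k ℕ.< p → p ∣ p C k
  prime∣C {k} 0<k k<p with euclidsLemma (p C k) (k ! ℕ.* (p ℕ.∸ k) !) p-prime (≡.subst (p ∣_) (sym p!≡) p∣p!)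
    where
    instance
      _ = k !* (p ℕ.∸ k) !≢0
    p!≡ : (p C k) ℕ.* (k ! ℕ.* (p ℕ.∸ k) !) ≡ p !
    p!≡ = trans (cong (ℕ._* (k ! ℕ.* (p ℕ.∸ k) !)) (nCk≡n!/k![n-k]! (ℕ.<⇒≤ k<p))) (m/n*n≡m (k![n∸k]!∣n! (ℕ.<⇒≤ k<p)))
    p∣p! : p ∣ p !
    p∣p! = ≡.subst (λ n → n ∣ n !) (ℕ.suc-pred p {{prime⇒nonZero p-prime}}) (m∣m*n _)
  ... | inj₁ p∣C = p∣C
  ... | inj₂ p∣k!* with euclidsLemma (k !) ((p ℕ.∸ k) !) p-prime p∣k!*
  ...   | inj₁ p∣k!     = contradiction p∣k! (prime∤! k<p)
  ...   | inj₂ p∣[p∸k]! = contradiction p∣[p∸k]! (prime∤! (ℕ.∸-monoʳ-< 0<k (ℕ.<⇒≤ k<p)))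

module FieldProperties {q} (𝔽 : FiniteField q) where
  open FiniteField 𝔽 public
  open CommutativeRing commutativeRing public using
    ( +-assoc; +-comm; +-identityˡ; +-identityʳ; -‿inverseˡ; -‿inverseʳ; *-assoc; *-comm; *-identityˡ; *-identityʳ
    ; zeroˡ; zeroʳ; distribˡ; distribʳ; +-group; ring; +-commutativeMonoid; *-commutativeMonoid; *-monoid; commutativeSemiring)
  open GroupProperties +-group public using (x∙y⁻¹≈ε⇒x≈y; x≈y⇒x∙y⁻¹≈ε; inverseʳ-unique; ∙-cancelˡ)
  open SemiringMult semiring public using (×-homo-+; ×1-homo-*; ×-assoc-*; ×-comm-*; ×-assocˡ)
  open CommutativeSemiringExp commutativeSemiring public using (^-assocʳ)
  open SemiringSum semiring public using (sum-init-last; sum-cong-≗; ∑-distrib-+)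
  open IntegerSolver commutativeRing public
  open ≡.≡-Reasoning

  *-cancelˡ-nonZero : ∀ {x y} → x ≢ 0# → x * y ≡ 0# → y ≡ 0#
  *-cancelˡ-nonZero {x} {y} x≢0 xy≡0 with x⁻¹ , xx⁻¹ ← inverse x≢0 = begin
    y               ≡⟨ *-identityˡ y ⟨
    1# * y          ≡⟨ cong (_* y) (trans (*-comm x⁻¹ x) xx⁻¹) ⟨
    x⁻¹ * x * y     ≡⟨ *-assoc x⁻¹ x y ⟩
    x⁻¹ * (x * y)   ≡⟨ cong (x⁻¹ *_) xy≡0 ⟩
    x⁻¹ * 0#        ≡⟨ zeroʳ x⁻¹ ⟩
    0#              ∎

  ^≡0⇒≡0 : ∀ x m → x ^ m ≡ 0# → x ≡ 0#
  ^≡0⇒≡0 x zero    1≡0 = contradiction (sym 1≡0) 0≢1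
  ^≡0⇒≡0 x (suc m) eq with x ≟ 0#
  ... | yes x≡0 = x≡0
  ... | no  x≢0 = ^≡0⇒≡0 x m (*-cancelˡ-nonZero x≢0 eq)

  -- Translation by `1#` permutes the field, yet adds `1#` to each of the `q` terms of the sum of
  -- all elements.
  q·1≡0 : q · 1# ≡ 0#
  q·1≡0 = ∙-cancelˡ (∑ (λ x → x)) (q · 1#) 0# (begin
    ∑ (λ x → x) + q · 1#              ≡⟨ cong (∑ (λ x → x) +_) (∑-const 1#) ⟨
    ∑ (λ x → x) + ∑ (λ _ → 1#)        ≡⟨ ∑-∙ (λ x → x) (λ _ → 1#) ⟨
    ∑ (λ x → x + 1#)                  ≡⟨ ∑-reindex {λ x → x} (_+ 1#) (_- 1#) (λ x → shift x 1#) (λ x → unshift x 1#) ⟨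
    ∑ (λ x → x)                       ≡⟨ +-identityʳ _ ⟨
    ∑ (λ x → x) + 0#                  ∎)
    where
    open FiniteSum +-commutativeMonoid enumeration
    shift : ∀ x y → x - y + y ≡ x
    shift x y = trans (+-assoc x (- y) y) (trans (cong (x +_) (-‿inverseˡ y)) (+-identityʳ x))
    unshift : ∀ x y → x + y - y ≡ x
    unshift x y = trans (+-assoc x y (- y)) (trans (cong (x +_) (-‿inverseʳ y)) (+-identityʳ x))

  private
    choose : ∀ {P : Set} → Dec P → Carrier → Carrier → Carrier
    choose P? x y = if does P? then x else y

  -- Multiplication by a permutes the nonzero elements; both products are extended to 𝔽 by a harmless factor at 0.
  ^q : ∀ {a} → a ≢ 0# → a ^ q ≡ a
  ^q {a} a≢0 = begin
    a ^ q                              ≡⟨ ∑-const a ⟨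
    ∑ (λ _ → a)                        ≡⟨ ∑-cong (λ x → split (x ≟ 0#)) ⟩
    ∑ (λ x → k x * j x)                ≡⟨ ∑-∙ k j ⟩
    ∑ k * ∑ j                          ≡⟨ cong₂ _*_ ∑k≡1 ∑j≡a ⟩
    1# * a                             ≡⟨ *-identityˡ a ⟩
    a                                  ∎
    where
    open FiniteSum *-commutativeMonoid enumeration
    open MonoidSum *-commutativeMonoid using () renaming (sum to product)
    h k j : Carrier → Carrier
    h x = choose (x ≟ 0#) 1# x
    k x = choose (x ≟ 0#) 1# a
    j x = choose (x ≟ 0#) a 1#
    split : ∀ {P : Set} (P? : Dec P) → a ≡ choose P? 1# a * choose P? a 1#
    split (yes _) = sym (*-identityˡ a)
    split (no _)  = sym (*-identityʳ a)
    ∑j≡a : ∑ j ≡ a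
    ∑j≡a = trans (∑-single 0# (λ x x≢0 → j-no (x ≟ 0#) x≢0)) (j-yes (0# ≟ 0#))
      where
      j-no : ∀ {x} (x≟0 : Dec (x ≡ 0#)) → x ≢ 0# → choose x≟0 a 1# ≡ 1#
      j-no (yes x≡0) x≢0 = contradiction x≡0 x≢0
      j-no (no _)    _   = refl
      j-yes : (0≟0 : Dec (0# ≡ 0#)) → choose 0≟0 a 1# ≡ a
      j-yes (yes _)  = refl
      j-yes (no 0≢0) = contradiction refl 0≢0
    h-* : ∀ {x} (x≟0 : Dec (x ≡ 0#)) (ax≟0 : Dec (a * x ≡ 0#)) → choose ax≟0 1# (a * x) ≡ choose x≟0 1# a * choose x≟0 1# x
    h-* (yes _)      (yes _)   = sym (*-identityˡ 1#)
    h-* (yes refl)   (no ax≢0) = contradiction (zeroʳ a) ax≢0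
    h-* (no x≢0)     (yes ax≡0) = contradiction (*-cancelˡ-nonZero a≢0 ax≡0) x≢0
    h-* (no _)       (no _)    = refl
    h-nonZero : ∀ {x} (x≟0 : Dec (x ≡ 0#)) → choose x≟0 1# x ≢ 0#
    h-nonZero (yes _)  1≡0 = 0≢1 (sym 1≡0)
    h-nonZero (no x≢0) x≡0 = x≢0 x≡0
    product-nonZero : ∀ {m} (t : Fin m → Carrier) → (∀ i → t i ≢ 0#) → product t ≢ 0#
    product-nonZero {zero}  t t≢0 1≡0 = 0≢1 (sym 1≡0)
    product-nonZero {suc m} t t≢0 eq  = product-nonZero (t ∘ suc) (t≢0 ∘ suc) (*-cancelˡ-nonZero (t≢0 zero) eq)
    ∑h≢0 : ∑ h ≢ 0#
    ∑h≢0 eq = product-nonZero (h ∘ element) (λ i → h-nonZero (element i ≟ 0#)) (trans (sym (∑≡sum h)) eq)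
    ∑h : ∑ h ≡ ∑ k * ∑ h
    ∑h with a⁻¹ , aa⁻¹ ← inverse a≢0 = begin
      ∑ h
        ≡⟨ ∑-reindex {h} (a *_) (a⁻¹ *_) (λ x → cancel a a⁻¹ x aa⁻¹) (λ x → cancel a⁻¹ a x (trans (*-comm a⁻¹ a) aa⁻¹)) ⟩
      ∑ (λ x → h (a * x))    ≡⟨ ∑-cong (λ x → h-* (x ≟ 0#) (a * x ≟ 0#)) ⟩
      ∑ (λ x → k x * h x)    ≡⟨ ∑-∙ k h ⟩
      ∑ k * ∑ h              ∎
      where
      cancel : ∀ x y z → x * y ≡ 1# → x * (y * z) ≡ z
      cancel x y z xy≡1 = trans (sym (*-assoc x y z)) (trans (cong (_* z) xy≡1) (*-identityˡ z))
    ∑k≡1 : ∑ k ≡ 1#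
    ∑k≡1 = x∙y⁻¹≈ε⇒x≈y (∑ k) 1# (*-cancelˡ-nonZero ∑h≢0 (begin
      ∑ h * (∑ k - 1#)           ≡⟨ distribˡ (∑ h) (∑ k) (- 1#) ⟩
      ∑ h * ∑ k + ∑ h * - 1#
        ≡⟨ cong₂ _+_ (*-comm (∑ h) (∑ k)) (trans (sym (-‿distribʳ-* (∑ h) 1#)) (cong -_ (*-identityʳ (∑ h)))) ⟩
      ∑ k * ∑ h - ∑ h            ≡⟨ x≈y⇒x∙y⁻¹≈ε (sym ∑h) ⟩
      0#                         ∎))
      where open RingProperties ring using (-‿distribʳ-*)

  -- Polynomial functions by a Horner presentation. The degree belongs to the presentation, not to
  -- the function: on a field of `q` elements the identity has degree 1 and, as `x ^ q`, degree `q`.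
  data Monic : ℕ → (Carrier → Carrier) → Set where
    constant : ∀ {f} → (∀ x → f x ≡ 1#) → Monic 0 f
    horner   : ∀ {d f g} c → Monic d g → (∀ x → f x ≡ c + x * g x) → Monic (suc d) f

  monic-^ : ∀ d → Monic d (_^ d)
  monic-^ zero    = constant (λ _ → refl)
  monic-^ (suc d) = horner 0# (monic-^ d) (λ x → sym (+-identityˡ _))

  monic-resp : ∀ {d f g} → (∀ x → g x ≡ f x) → Monic d f → Monic d g
  monic-resp g≡f (constant f≡1)       = constant (λ x → trans (g≡f x) (f≡1 x))
  monic-resp g≡f (horner c m f≡) = horner c m (λ x → trans (g≡f x) (f≡ x))

  monic-+-const : ∀ {d f} → Monic (suc d) f → ∀ c → Monic (suc d) (λ x → f x + c)
  monic-+-const (horner c₀ g f≡) c = horner (c₀ + c) g (λ x → trans (cong (_+ c) (f≡ x))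
    (trans (+-assoc _ _ _) (trans (cong (c₀ +_) (+-comm _ c)) (sym (+-assoc _ _ _)))))

  monic-+-^ : ∀ {d f} → Monic d f → ∀ {e} → e ℕ.< d → Monic d (λ x → f x + x ^ e)
  monic-+-^ m@(horner _ _ _)  {zero}  _         = monic-+-const m 1#
  monic-+-^ (horner {g = g} c m f≡) {suc e} (s≤s e<d) = horner c (monic-+-^ m e<d) (λ x → begin
    _                                  ≡⟨ cong (_+ x * x ^ e) (f≡ x) ⟩
    c + x * g x + x * x ^ e            ≡⟨ +-assoc _ _ _ ⟩
    c + (x * g x + x * x ^ e)          ≡⟨ cong (c +_) (distribˡ x (g x) (x ^ e)) ⟨
    c + x * (g x + x ^ e)              ∎)

  -- The factor theorem. For `f x = c + x * g x` one has `f x - f r = (x - r) * g r + x * (g x - g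
  -- r)`, and the induction hypothesis takes `x - r` out of the last difference.
  monic-divide : ∀ {d f} → Monic (suc d) f → ∀ r → ∃[ g ] Monic d g × (∀ x → f x - f r ≡ (x - r) * g x)
  monic-divide {f = f} (horner {g = g} c (constant g≡1) f≡) r = g , constant g≡1 , λ x → begin
    f x - f r                              ≡⟨ cong₂ _-_ (f≡ x) (f≡ r) ⟩
    (c + x * g x) - (c + r * g r)          ≡⟨ cong (λ t → (c + x * g x) - (c + r * t)) (trans (g≡1 r) (sym (g≡1 x))) ⟩
    (c + x * g x) - (c + r * g x)
      ≡⟨ solve 4 (λ c x r t → (c :+ x :* t) :- (c :+ r :* t) := (x :- r) :* t) refl c x r (g x) ⟩
    (x - r) * g x                          ∎
  monic-divide {f = f} (horner {g = g} c m@(horner _ _ _) f≡) r with k , k-monic , k≡ ← monic-divide m r =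
    (λ x → g r + x * k x) , horner (g r) k-monic (λ _ → refl) , λ x → begin
      f x - f r                                  ≡⟨ cong₂ _-_ (f≡ x) (f≡ r) ⟩
      (c + x * g x) - (c + r * g r)
        ≡⟨ solve 5 (λ c x r s t → (c :+ x :* s) :- (c :+ r :* t) := (x :- r) :* t :+ x :* (s :- t)) refl c x r (g x) (g r) ⟩
      (x - r) * g r + x * (g x - g r)            ≡⟨ cong (λ t → (x - r) * g r + x * t) (k≡ x) ⟩
      (x - r) * g r + x * ((x - r) * k x)
        ≡⟨ solve 4 (λ x r s t → (x :- r) :* s :+ x :* ((x :- r) :* t) := (x :- r) :* (s :+ x :* t)) refl x r (g r) (k x) ⟩
      (x - r) * (g r + x * k x)                  ∎

  -- After division by the first root, the remaining roots, being different from it, are roots of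
  -- the quotient since a field has no zero divisors.
  roots≤degree : ∀ {d f} → Monic d f → ∀ {m} (r : Fin m → Carrier) → (∀ {i j} → r i ≡ r j → i ≡ j) →
                 (∀ i → f (r i) ≡ 0#) → m ℕ.≤ d
  roots≤degree m {zero} r r-inj root = z≤n
  roots≤degree (constant f≡1) {suc m} r r-inj root = contradiction (trans (sym (root zero)) (f≡1 (r zero))) 0≢1
  roots≤degree {f = f} monic@(horner _ _ _) {suc m} r r-inj root with g , g-monic , g≡ ← monic-divide monic (r zero) =
    s≤s (roots≤degree g-monic (r ∘ suc) (λ eq → suc-injective (r-inj eq)) (λ i → *-cancelˡ-nonZero
      (λ eq → contradiction (r-inj (x∙y⁻¹≈ε⇒x≈y (r (suc i)) (r zero) eq)) (λ ()))
      (trans (sym (g≡ (r (suc i)))) (trans (cong₂ _-_ (root (suc i)) (root zero)) (-‿inverseʳ 0#)))))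

module Trace {p n : ℕ} (p-prime : Prime p) (𝔽 : FiniteField (p ℕ.^ n)) where
  open FieldProperties 𝔽
  open import Data.Fin.Base using (fromℕ)
  open ≡.≡-Reasoning
  open Inverse enumeration using (to; strictlyInverseʳ; strictlyInverseˡ)

  private instance
    p-nonZero : NonZero p
    p-nonZero = prime⇒nonZero p-prime

  1<p : 1 ℕ.< p
  1<p = ℕ.nonTrivial⇒n>1 p {{prime⇒nonTrivial p-prime}}

  ι : ℕ → Carrier
  ι m = m · 1#

  ι-^ : ∀ m k → ι (m ℕ.^ k) ≡ ι m ^ k
  ι-^ m zero    = +-identityʳ 1#
  ι-^ m (suc k) = trans (×1-homo-* m (m ℕ.^ k)) (cong (ι m *_) (ι-^ m k))

  -- The `n`-th power of `ι p` is `q · 1# = 0#`, and a field has no nilpotent elements except 0.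
  ι-p : ι p ≡ 0#
  ι-p = ^≡0⇒≡0 (ι p) n (trans (sym (ι-^ p n)) q·1≡0)

  ι-*p : ∀ k → ι (k ℕ.* p) ≡ 0#
  ι-*p k = trans (×1-homo-* k p) (trans (cong (ι k *_) ι-p) (zeroʳ (ι k)))

  ι-% : ∀ m → ι (m % p) ≡ ι m
  ι-% m = sym (begin
    ι m                                ≡⟨ cong ι (m≡m%n+[m/n]*n m p) ⟩
    ι (m % p ℕ.+ m / p ℕ.* p)          ≡⟨ ×-homo-+ 1# (m % p) (m / p ℕ.* p) ⟩
    ι (m % p) + ι (m / p ℕ.* p)        ≡⟨ cong (ι (m % p) +_) (ι-*p (m / p)) ⟩
    ι (m % p) + 0#                     ≡⟨ +-identityʳ _ ⟩
    ι (m % p)                          ∎)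

  -- By Bézout, multiples of `p` and of `m` differ by 1; if `ι` killed both, it would kill 1.
  ι≢0 : ∀ {m} → 0 ℕ.< m → m ℕ.< p → ι m ≢ 0#
  ι≢0 {m} 0<m m<p ιm≡0 = bezout (coprime-Bézout (prime⇒coprime p-prime {{ℕ.>-nonZero 0<m}} m<p))
    where
    ι-*m : ∀ k → ι (k ℕ.* m) ≡ 0#
    ι-*m k = trans (×1-homo-* k m) (trans (cong (ι k *_) ιm≡0) (zeroʳ (ι k)))
    1≢ : ∀ {s t} → 1 ℕ.+ s ≡ t → ι s ≡ 0# → ι t ≢ 0#
    1≢ {s} 1+s≡t s≡0 t≡0 = 0≢1 (trans (sym t≡0) (trans (cong ι (sym 1+s≡t)) (trans (cong (1# +_) s≡0) (+-identityʳ 1#))))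
    bezout : ¬ Bézout.Identity 1 p m
    bezout (Bézout.+- x y eq) = 1≢ eq (ι-*m y) (ι-*p x)
    bezout (Bézout.-+ x y eq) = 1≢ eq (ι-*p x) (ι-*m y)

  ι-< : ∀ {s t} → s ℕ.< t → t ℕ.< p → ι s ≢ ι t
  ι-< {s} {t} s<t t<p eq = ι≢0 (ℕ.m<n⇒0<n∸m s<t) (ℕ.≤-<-trans (ℕ.m∸n≤m t s) t<p) (∙-cancelˡ (ι s) _ _ (begin
    ι s + ι (t ℕ.∸ s)     ≡⟨ ×-homo-+ 1# s (t ℕ.∸ s) ⟨
    ι (s ℕ.+ (t ℕ.∸ s))   ≡⟨ cong ι (ℕ.m+[n∸m]≡n (ℕ.<⇒≤ s<t)) ⟩
    ι t                   ≡⟨ eq ⟨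
    ι s                   ≡⟨ +-identityʳ (ι s) ⟨
    ι s + 0#              ∎))

  ι-injective : ∀ {s t} → s ℕ.< p → t ℕ.< p → ι s ≡ ι t → s ≡ t
  ι-injective {s} {t} s<p t<p eq with ℕ.<-cmp s t
  ... | tri< s<t _ _ = contradiction eq (ι-< s<t t<p)
  ... | tri≈ _ s≡t _ = s≡t
  ... | tri> _ _ t<s = contradiction (sym eq) (ι-< t<s s<p)

  ·-multiple : ∀ {m} → p ∣ m → ∀ x → m · x ≡ 0#
  ·-multiple {m} (divides k m≡kp) x = begin
    m · x             ≡⟨ cong (m ·_) (*-identityˡ x) ⟨
    m · (1# * x)      ≡⟨ ×-assoc-* m 1# x ⟨
    ι m * x           ≡⟨ cong (_* x) (trans (cong ι m≡kp) (ι-*p k)) ⟩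
    0# * x            ≡⟨ zeroˡ x ⟩
    0#                ∎

  frobenius-+ : ∀ x y → (x + y) ^ p ≡ x ^ p + y ^ p
  frobenius-+ x y = trans (Bin.theorem p x y) (expansion p refl)
    where
    module Bin = Binomial commutativeSemiring
    -- The exponent is a variable equal to `p`, so that it can be matched as a successor and the
    -- first and last binomial terms split off.
    expansion : ∀ m → m ≡ p → Bin.binomialExpansion x y m ≡ x ^ m + y ^ m
    expansion zero      m≡p = contradiction (≡.subst (1 ℕ.<_) (sym m≡p) 1<p) (λ ())
    expansion m@(suc k) m≡p = begin
      t zero + sum (t ∘ suc)                                  ≡⟨ cong₂ _+_ first (sum-init-last (t ∘ suc)) ⟩
      y ^ m + (sum (t ∘ suc ∘ inject₁) + t (fromℕ m))         ≡⟨ cong₂ (λ s u → y ^ m + (s + u)) middle last ⟩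
      y ^ m + (0# + x ^ m)                                    ≡⟨ cong (y ^ m +_) (+-identityˡ (x ^ m)) ⟩
      y ^ m + x ^ m                                           ≡⟨ +-comm (y ^ m) (x ^ m) ⟩
      x ^ m + y ^ m                                           ∎
      where
      t : Fin (suc m) → Carrier
      t = Bin.binomialTerm x y m
      first : t zero ≡ y ^ m
      first = trans (+-identityʳ _) (*-identityˡ _)
      last : t (fromℕ m) ≡ x ^ m
      last = begin
        (m C toℕ (fromℕ m)) · (x ^ toℕ (fromℕ m) * y ^ (m ℕ.∸ toℕ (fromℕ m)))
          ≡⟨ cong (λ i → (m C i) · (x ^ i * y ^ (m ℕ.∸ i))) (toℕ-fromℕ m) ⟩
        (m C m) · (x ^ m * y ^ (m ℕ.∸ m))
          ≡⟨ cong₂ (λ c e → c · (x ^ m * y ^ e)) (nCn≡1 m) (ℕ.n∸n≡0 m) ⟩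
        1 · (x ^ m * 1#)                                                      ≡⟨ trans (+-identityʳ _) (*-identityʳ _) ⟩
        x ^ m                                                                 ∎
      sum-0 : ∀ {l} (s : Fin l → Carrier) → (∀ i → s i ≡ 0#) → sum s ≡ 0#
      sum-0 {zero}  s s≡0 = refl
      sum-0 {suc l} s s≡0 = trans (cong₂ _+_ (s≡0 zero) (sum-0 (s ∘ suc) (s≡0 ∘ suc))) (+-identityʳ 0#)
      middle : sum (t ∘ suc ∘ inject₁) ≡ 0#
      middle = sum-0 (t ∘ suc ∘ inject₁) (λ i → ·-multiple (≡.subst (λ l → p ∣ l C suc (toℕ (inject₁ i))) (sym m≡p)
        (prime∣C p-prime (s≤s z≤n) (≡.subst (suc (toℕ (inject₁ i)) ℕ.<_) m≡p (s≤s (≡.subst (ℕ._< k) (sym (toℕ-inject₁ i)) (toℕ<n i)))))) _)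

  0^ : ∀ {k} → 0 ℕ.< k → 0# ^ k ≡ 0#
  0^ (s≤s _) = zeroˡ _

  1^ : ∀ k → 1# ^ k ≡ 1#
  1^ zero    = refl
  1^ (suc k) = trans (*-identityˡ _) (1^ k)

  frobenius-ι : ∀ m → ι m ^ p ≡ ι m
  frobenius-ι zero    = 0^ (ℕ.<-trans (s≤s z≤n) 1<p)
  frobenius-ι (suc m) = trans (frobenius-+ 1# (ι m)) (cong₂ _+_ (1^ p) (frobenius-ι m))

  frobenius-sum : ∀ {m} (t : Fin m → Carrier) → sum t ^ p ≡ sum (λ i → t i ^ p)
  frobenius-sum {zero}  t = frobenius-ι 0
  frobenius-sum {suc m} t = trans (frobenius-+ (t zero) (sum (t ∘ suc))) (cong (t zero ^ p +_) (frobenius-sum (t ∘ suc)))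

  frobenius^-+ : ∀ k x y → (x + y) ^ (p ℕ.^ k) ≡ x ^ (p ℕ.^ k) + y ^ (p ℕ.^ k)
  frobenius^-+ zero    x y = trans (*-identityʳ _) (sym (cong₂ _+_ (*-identityʳ x) (*-identityʳ y)))
  frobenius^-+ (suc k) x y = begin
    (x + y) ^ (p ℕ.* p ℕ.^ k)                            ≡⟨ ^-assocʳ (x + y) p (p ℕ.^ k) ⟨
    ((x + y) ^ p) ^ (p ℕ.^ k)                            ≡⟨ cong (_^ (p ℕ.^ k)) (frobenius-+ x y) ⟩
    (x ^ p + y ^ p) ^ (p ℕ.^ k)                          ≡⟨ frobenius^-+ k (x ^ p) (y ^ p) ⟩
    (x ^ p) ^ (p ℕ.^ k) + (y ^ p) ^ (p ℕ.^ k)            ≡⟨ cong₂ _+_ (^-assocʳ x p (p ℕ.^ k)) (^-assocʳ y p (p ℕ.^ k)) ⟩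
    x ^ (p ℕ.^ suc k) + y ^ (p ℕ.^ suc k)                ∎

  -- The `p` elements `ι t` are already roots of `x ^ p - x`. A fixed point outside them, put in
  -- front as `r zero`, would be root number `p + 1`.
  fixed⇒prime-field : ∀ u → u ^ p ≡ u → ∃[ t ] t ℕ.< p × ι t ≡ u
  fixed⇒prime-field u u^p≡u with any? (λ (t : Fin p) → ι (toℕ t) ≟ u)
  ... | yes (t , ιt≡u) = toℕ t , toℕ<n t , ιt≡u
  ... | no ∄t = contradiction (roots≤degree x^p-x-monic r r-injective root) (ℕ.<⇒≱ (ℕ.n<1+n p))
    where
    x^p-x : ∀ m → 1 ℕ.< m → Monic m (λ x → x ^ m - x)
    x^p-x (suc (suc m)) (s≤s (s≤s _)) = horner 0# (horner (- 1#) (monic-^ m) (λ x → refl)) (λ x → begin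
      x * (x * x ^ m) - x                    ≡⟨ cong (λ t → x * (x * x ^ m) - t) (*-identityʳ x) ⟨
      x * (x * x ^ m) - x * 1#
        ≡⟨ solve 3 (λ x e o → x :* (x :* e) :- x :* o := x :* (:- o :+ x :* e)) refl x (x ^ m) 1# ⟩
      x * (- 1# + x * x ^ m)                 ≡⟨ +-identityˡ _ ⟨
      0# + x * (- 1# + x * x ^ m)            ∎)
    x^p-x-monic : Monic p (λ x → x ^ p - x)
    x^p-x-monic = x^p-x p 1<p
    r : Fin (suc p) → Carrier
    r zero    = u
    r (suc t) = ι (toℕ t)
    r-injective : ∀ {i j} → r i ≡ r j → i ≡ j
    r-injective {zero}  {zero}  _  = refl
    r-injective {zero}  {suc j} eq = contradiction (j , sym eq) ∄t
    r-injective {suc i} {zero}  eq = contradiction (i , eq) ∄t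
    r-injective {suc i} {suc j} eq = cong suc (toℕ-injective (ι-injective (toℕ<n i) (toℕ<n j) eq))
    root : ∀ i → r i ^ p - r i ≡ 0#
    root zero    = x≈y⇒x∙y⁻¹≈ε u^p≡u
    root (suc i) = x≈y⇒x∙y⁻¹≈ε (frobenius-ι (toℕ i))

  tr : Carrier → Carrier
  tr = Tr {p} {n} 𝔽

  res : Carrier → ℕ
  res = residue {p} {n} 𝔽

  tr-+ : ∀ x y → tr (x + y) ≡ tr x + tr y
  tr-+ x y =
    trans (sum-cong-≗ (λ (i : Fin n) → frobenius^-+ (toℕ i) x y)) (∑-distrib-+ {n} (λ i → x ^ (p ℕ.^ toℕ i)) (λ i → y ^ (p ℕ.^ toℕ i)))

  tr-0 : tr 0# ≡ 0#
  tr-0 = ∙-cancelˡ (tr 0#) _ _ (trans (sym (tr-+ 0# 0#)) (trans (cong tr (+-identityʳ 0#)) (sym (+-identityʳ _))))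

  tr-neg : ∀ x → tr (- x) ≡ - tr x
  tr-neg x = inverseʳ-unique (tr x) (tr (- x)) (trans (sym (tr-+ x (- x))) (trans (cong tr (-‿inverseʳ x)) tr-0))

  x^q≡x : ∀ x → x ^ (p ℕ.^ n) ≡ x
  x^q≡x x with x ≟ 0#
  ... | yes refl = 0^ (ℕ.m^n>0 p n)
  ... | no x≢0   = ^q x≢0

  -- Raising to the p-th power permutes the conjugates x^(p^i) cyclically.
  tr^p : ∀ x → tr x ^ p ≡ tr x
  tr^p x = begin
    tr x ^ p                                               ≡⟨ frobenius-sum {n} (λ i → g (toℕ i)) ⟩
    sum (λ (i : Fin n) → g (toℕ i) ^ p)
      ≡⟨ sum-cong-≗ (λ (i : Fin n) → trans (^-assocʳ x (p ℕ.^ toℕ i) p) (cong (x ^_) (ℕ.*-comm (p ℕ.^ toℕ i) p))) ⟩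
    sum (λ (i : Fin n) → g (suc (toℕ i)))                  ≡⟨ ∙-cancelˡ (g 0) _ _ cyclic ⟩
    tr x                                                   ∎
    where
    g : ℕ → Carrier
    g i = x ^ (p ℕ.^ i)
    shift : ∀ m (g : ℕ → Carrier) → g 0 + sum (λ (i : Fin m) → g (suc (toℕ i))) ≡ sum (λ (i : Fin m) → g (toℕ i)) + g m
    shift zero    g = +-comm (g 0) 0#
    shift (suc m) g = trans (cong (g 0 +_) (shift m (g ∘ suc))) (sym (+-assoc _ _ _))
    cyclic : g 0 + sum (λ (i : Fin n) → g (suc (toℕ i))) ≡ g 0 + tr x
    cyclic = trans (shift n g) (trans (+-comm (tr x) (g n)) (cong (_+ tr x) (trans (x^q≡x x) (sym (*-identityʳ x)))))

  tr-prime-field : ∀ x → ∃[ t ] t ℕ.< p × ι t ≡ tr x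
  tr-prime-field x = fixed⇒prime-field (tr x) (tr^p x)

  -- The search in `residue` succeeds here, with `m % p` as a witness, so its default value is never
  -- reached; injectivity of `ι` below `p` fixes what it finds.
  res-ι : ∀ m → res (ι m) ≡ m % p
  res-ι m with any? (λ (t : Fin p) → ι (toℕ t) ≟ ι m)
  ... | yes (t , ιt≡ιm) = ι-injective (toℕ<n t) (m%n<n m p) (trans ιt≡ιm (sym (ι-% m)))
  ... | no ∄t = contradiction (fromℕ< (m%n<n m p) , trans (cong ι (toℕ-fromℕ< (m%n<n m p))) (ι-% m)) ∄t

  -- The trace is a polynomial of degree `p ^ (n - 1)`, which is too small for all `p ^ n` elements
  -- to be roots. The case `n = 0` has no such degree and is excluded first: a field with one
  -- element would have `0# ≡ 1#`.
  tr-nontrivial : ∃[ c ] tr c ≢ 0#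
  tr-nontrivial = element (proj₁ nonzero) , proj₂ nonzero
    where
    element-injective : ∀ {i j} → element i ≡ element j → i ≡ j
    element-injective {i} {j} eq = trans (sym (strictlyInverseˡ i)) (trans (cong to eq) (strictlyInverseˡ j))
    n≢0 : n ≢ 0
    n≢0 n≡0 =
      0≢1 (trans (sym (strictlyInverseʳ 0#)) (trans (cong element (all-equal (cong (p ℕ.^_) n≡0) (to 0#) (to 1#))) (strictlyInverseʳ 1#)))
      where
      all-equal : ∀ {k} → k ≡ 1 → (i j : Fin k) → i ≡ j
      all-equal refl zero zero = refl
    monic-+-sum : ∀ {d f} → Monic d f → ∀ {k} (e : Fin k → ℕ) → (∀ i → e i ℕ.< d) → Monic d (λ x → f x + sum (λ i → x ^ e i))
    monic-+-sum m {zero}  e e<d = monic-resp (λ x → +-identityʳ _) m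
    monic-+-sum m {suc k} e e<d =
      monic-resp (λ x → sym (+-assoc _ _ _)) (monic-+-sum (monic-+-^ m (e<d zero)) (e ∘ suc) (e<d ∘ suc))
    too-many-roots : ∀ k → k ≢ 0 → (r : Fin (p ℕ.^ k) → Carrier) → (∀ {i j} → r i ≡ r j → i ≡ j) →
                     ¬ (∀ i → sum (λ (j : Fin k) → r i ^ (p ℕ.^ toℕ j)) ≡ 0#)
    too-many-roots zero    0≢0 _ _ _ = 0≢0 refl
    too-many-roots (suc k) _   r r-injective root =
      ℕ.<⇒≱ (ℕ.^-monoʳ-< p 1<p (ℕ.n<1+n k)) (roots≤degree monic r r-injective root)
      where
      monic : Monic (p ℕ.^ k) (λ x → sum (λ (j : Fin (suc k)) → x ^ (p ℕ.^ toℕ j)))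
      -- The top conjugate is moved to the front, because lower powers can only be added to a
      -- function already known to be monic.
      monic = monic-resp (λ x → begin
          sum (λ (j : Fin (suc k)) → x ^ (p ℕ.^ toℕ j))
            ≡⟨ sum-init-last (λ (j : Fin (suc k)) → x ^ (p ℕ.^ toℕ j)) ⟩
          sum (λ (j : Fin k) → x ^ (p ℕ.^ toℕ (inject₁ j))) + x ^ (p ℕ.^ toℕ (fromℕ k))
            ≡⟨ cong (λ e → sum (λ (j : Fin k) → x ^ (p ℕ.^ toℕ (inject₁ j))) + x ^ (p ℕ.^ e)) (toℕ-fromℕ k) ⟩
          sum (λ (j : Fin k) → x ^ (p ℕ.^ toℕ (inject₁ j))) + x ^ (p ℕ.^ k)              ≡⟨ +-comm _ _ ⟩
          x ^ (p ℕ.^ k) + sum (λ (j : Fin k) → x ^ (p ℕ.^ toℕ (inject₁ j)))              ∎)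
        (monic-+-sum (monic-^ (p ℕ.^ k)) (λ j → p ℕ.^ toℕ (inject₁ j))
          (λ j → ℕ.^-monoʳ-< p 1<p (≡.subst (ℕ._< k) (sym (toℕ-inject₁ j)) (toℕ<n j))))
    nonzero = ¬∀⟶∃¬ (p ℕ.^ n) (λ i → tr (element i) ≡ 0#) (λ i → tr (element i) ≟ 0#)
      (too-many-roots n n≢0 element element-injective)

module TraceCharacter {c ℓ} (R : CommutativeRing c ℓ) {p n : ℕ} (p-prime : Prime p) (𝔽 : FiniteField (p ℕ.^ n)) where
  open CommutativeRing R hiding (zero) renaming (refl to ≈-refl; sym to ≈-sym; trans to ≈-trans)
  open SemiringExp semiring using (_^_; ^-congˡ; ^-homo-*; ^-assocʳ)
  private module K = FieldProperties 𝔽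
  open Trace {p} {n} p-prime 𝔽
  open FiniteSum +-commutativeMonoid K.enumeration
  open SemiringSum semiring using (*-distribˡ-sum)
  open import Relation.Binary.Reasoning.Setoid setoid
  private instance
    p-nonZero : NonZero p
    p-nonZero = prime⇒nonZero p-prime

  NoZeroDivisors : Set _
  NoZeroDivisors = ∀ {x y} → ¬ x ≈ 0# → x * y ≈ 0# → y ≈ 0#

  module _ (cancel : NoZeroDivisors) (ζ : Carrier) (ζ^p≈1 : ζ ^ p ≈ 1#) (ζ^k≉1 : ∀ k → 0 ℕ.< k → k ℕ.< p → ¬ ζ ^ k ≈ 1#) where

    χ : K.Carrier → Carrier
    χ x = ζ ^ res (tr x)

    ζ-% : ∀ m → ζ ^ (m % p) ≈ ζ ^ m
    ζ-% m = begin
      ζ ^ (m % p)                            ≈⟨ *-identityʳ _ ⟨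
      ζ ^ (m % p) * 1#                       ≈⟨ *-congˡ (≈-trans (^-congˡ (m / p) ζ^p≈1) (1^ᴿ (m / p))) ⟨
      ζ ^ (m % p) * (ζ ^ p) ^ (m / p)        ≈⟨ *-congˡ (^-assocʳ ζ p (m / p)) ⟩
      ζ ^ (m % p) * ζ ^ (p ℕ.* (m / p))      ≈⟨ ^-homo-* ζ (m % p) _ ⟨
      ζ ^ (m % p ℕ.+ p ℕ.* (m / p))
        ≡⟨ cong (ζ ^_) (trans (cong (m % p ℕ.+_) (ℕ.*-comm p (m / p))) (sym (m≡m%n+[m/n]*n m p))) ⟩
      ζ ^ m                                  ∎
      where
      1^ᴿ : ∀ k → 1# ^ k ≈ 1#
      1^ᴿ zero    = ≈-refl
      1^ᴿ (suc k) = ≈-trans (*-identityˡ _) (1^ᴿ k)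

    -- Any natural representative of the trace may serve as the exponent of `ζ`, so additivity of
    -- `χ` can be checked on `s + t` without reduction modulo `p`.
    χ-ι : ∀ {x} m → ι m ≡ tr x → χ x ≈ ζ ^ m
    χ-ι {x} m ιm≡ = ≈-trans (reflexive (cong (ζ ^_) (trans (cong res (sym ιm≡)) (res-ι m)))) (ζ-% m)

    χ-0 : χ K.0# ≈ 1#
    χ-0 = χ-ι 0 (sym tr-0)

    χ-+ : ∀ x y → χ (x K.+ y) ≈ χ x * χ y
    χ-+ x y with s , _ , ιs≡ ← tr-prime-field x | t , _ , ιt≡ ← tr-prime-field y = begin
      χ (x K.+ y)        ≈⟨ χ-ι (s ℕ.+ t) (trans (K.×-homo-+ K.1# s t) (trans (cong₂ K._+_ ιs≡ ιt≡) (sym (tr-+ x y)))) ⟩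
      ζ ^ (s ℕ.+ t)      ≈⟨ ^-homo-* ζ s t ⟩
      ζ ^ s * ζ ^ t      ≈⟨ *-cong (χ-ι s ιs≡) (χ-ι t ιt≡) ⟨
      χ x * χ y          ∎

    -- Translation by an element `e` of nonzero trace multiplies the sum by `χ e`, which is not 1
    -- because `ζ` is primitive and the exponent lies strictly between 0 and `p`.
    ∑χ≈0 : ∑ χ ≈ 0#
    ∑χ≈0 = cancel χc-1≉0 (begin
      (χ e - 1#) * ∑ χ                    ≈⟨ [y-z]x≈yx-zx (∑ χ) (χ e) 1# ⟩
      χ e * ∑ χ - 1# * ∑ χ                ≈⟨ +-cong shift (-‿cong (*-identityˡ _)) ⟩
      ∑ χ - ∑ χ                           ≈⟨ -‿inverseʳ _ ⟩
      0#                                  ∎)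
      where
      open RingProperties ring using ([y-z]x≈yx-zx)
      open GroupProperties +-group using (x∙y⁻¹≈ε⇒x≈y)
      e : K.Carrier
      e = proj₁ tr-nontrivial
      χc-1≉0 : ¬ χ e - 1# ≈ 0#
      χc-1≉0 eq with t , t<p , ιt≡ ← tr-prime-field e =
        ζ^k≉1 t (ℕ.n≢0⇒n>0 (λ t≡0 → proj₂ tr-nontrivial (trans (sym ιt≡) (cong ι t≡0)))) t<p
          (≈-trans (≈-sym (χ-ι t ιt≡)) (x∙y⁻¹≈ε⇒x≈y (χ e) 1# eq))
      shift : χ e * ∑ χ ≈ ∑ χ
      shift = begin
        χ e * ∑ χ
          ≈⟨ ≈-trans (*-congˡ (reflexive (∑≡sum χ))) (≈-trans (*-distribˡ-sum (χ e) (χ ∘ K.element)) (reflexive (sym (∑≡sum _)))) ⟩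
        ∑ (λ x → χ e * χ x)               ≈⟨ ∑-cong (λ x → χ-+ e x) ⟨
        ∑ (λ x → χ (e K.+ x))             ≈⟨ ∑-reindex {χ} (e K.+_) (K.- e K.+_)
                                               (λ x → trans (sym (K.+-assoc e (K.- e) x)) (trans (cong (K._+ x) (K.-‿inverseʳ e)) (K.+-identityˡ x)))
                                               (λ x → trans (sym (K.+-assoc (K.- e) e x)) (trans (cong (K._+ x) (K.-‿inverseˡ e)) (K.+-identityˡ x))) ⟨
        ∑ χ                               ∎

    isNontrivialCharacter : IsNontrivialCharacter R 𝔽 χ
    isNontrivialCharacter = record { χ-0 = χ-0 ; χ-+ = χ-+ ; ∑χ≈0 = ∑χ≈0 }

-- Real and complex numbers

module RealProperties {c ℓ₁ ℓ₂} (ℝ : RealNumbers c ℓ₁ ℓ₂) where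
  open RealNumbers ℝ hiding (zero) renaming (refl to ≈-refl; sym to ≈-sym; trans to ≈-trans)
  open IsStrictPartialOrder isStrictPartialOrder using (irrefl; <-resp-≈) renaming (trans to <-trans)
  open IntegerSolver commutativeRing

  <-respˡ : ∀ {x y z} → x ≈ y → x < z → y < z
  <-respˡ = proj₂ <-resp-≈

  <-respʳ : ∀ {x y z} → x ≈ y → z < x → z < y
  <-respʳ = proj₁ <-resp-≈

  neg-pos : ∀ {x} → x < 0# → 0# < - x
  neg-pos {x} x<0 = <-respˡ (-‿inverseˡ x) (<-respʳ (+-identityʳ (- x)) (+-monoʳ-< (- x) x<0))

  square-pos⁻ : ∀ {x} → x < 0# → 0# < x * x
  square-pos⁻ {x} x<0 = <-respʳ (solve 1 (λ x → (:- x) :* (:- x) := x :* x) ≈-refl x) (*-pos (neg-pos x<0) (neg-pos x<0))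

  -- In place of trichotomy: a negative square excludes both signs of `x`, so tightness gives
  -- `x ≈ 0#`, whose square is not negative.
  square-nonneg : ∀ x → 0# ≤ x * x
  square-nonneg x xx<0 = irrefl (≈-trans (*-congʳ x≈0) (zeroˡ x)) xx<0
    where
    x≈0 : x ≈ 0#
    x≈0 =
      <-tight (λ x<0 → irrefl ≈-refl (<-trans xx<0 (square-pos⁻ x<0))) (λ 0<x → irrefl ≈-refl (<-trans xx<0 (*-pos 0<x 0<x)))

  -- Cotransitivity places `x + y` against `0# < x`: it is positive, or it lies below `x` and then
  -- `y` is negative.
  0<pos+nonneg : ∀ {x y} → 0# < x → 0# ≤ y → 0# < x + y
  0<pos+nonneg {x} {y} 0<x 0≤y with <-cotrans 0<x (x + y)
  ... | inj₁ 0<x+y = 0<x+y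
  ... | inj₂ x+y<x = contradiction (<-respˡ (solve 2 (λ x y → :- x :+ (x :+ y) := y) ≈-refl x y)
                       (<-respʳ (-‿inverseˡ x) (+-monoʳ-< (- x) x+y<x))) 0≤y

  +-nonneg : ∀ {x y} → 0# ≤ x → 0# ≤ y → 0# ≤ x + y
  +-nonneg {x} {y} 0≤x 0≤y x+y<0 with <-cotrans x+y<0 x
  ... | inj₁ x+y<x = 0≤y (<-respˡ (solve 2 (λ x y → :- x :+ (x :+ y) := y) ≈-refl x y)
                       (<-respʳ (-‿inverseˡ x) (+-monoʳ-< (- x) x+y<x)))
  ... | inj₂ x<0   = 0≤x x<0

  -- Only elements apart from 0 have inverses. If `y` were positive or negative, its inverse would
  -- force `x ≈ 0#`; with both signs excluded, tightness applies to `y`.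
  noZeroDivisors : ∀ {x y} → ¬ x ≈ 0# → x * y ≈ 0# → y ≈ 0#
  noZeroDivisors {x} {y} x≉0 xy≈0 = <-tight
    (λ y<0 → x≉0 (apart (inj₁ y<0)))
    (λ 0<y → x≉0 (apart (inj₂ 0<y)))
    where
    apart : y < 0# ⊎ 0# < y → x ≈ 0#
    apart y#0 with y⁻¹ , yy⁻¹ ← inverse y#0 = begin
      x                ≈⟨ *-identityʳ x ⟨
      x * 1#           ≈⟨ *-congˡ yy⁻¹ ⟨
      x * (y * y⁻¹)    ≈⟨ *-assoc x y y⁻¹ ⟨
      x * y * y⁻¹      ≈⟨ *-congʳ xy≈0 ⟩
      0# * y⁻¹         ≈⟨ zeroˡ y⁻¹ ⟩
      0#               ∎
      where open import Relation.Binary.Reasoning.Setoid setoid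

  squares≈0 : ∀ {x y} → x * x + y * y ≈ 0# → x ≈ 0#
  squares≈0 {x} {y} eq = <-tight (λ x<0 → positive (square-pos⁻ x<0)) (λ 0<x → positive (*-pos 0<x 0<x))
    where
    positive : ¬ 0# < x * x
    positive 0<xx = irrefl (≈-sym eq) (0<pos+nonneg 0<xx (square-nonneg y))

  fromℕ-nonneg : ∀ m → 0# ≤ fromℕ m
  fromℕ-nonneg zero    = irrefl ≈-refl
  fromℕ-nonneg (suc m) 1+m<0 = irrefl ≈-refl (<-trans 1+m<0 (0<pos+nonneg 0<1 (fromℕ-nonneg m)))

  char0 : CharacteristicZero commutativeRing
  char0 zero    zero    _  = ≡.refl
  char0 zero    (suc n) eq = contradiction (0<pos+nonneg 0<1 (fromℕ-nonneg n)) (irrefl eq)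
  char0 (suc m) zero    eq = contradiction (0<pos+nonneg 0<1 (fromℕ-nonneg m)) (irrefl (≈-sym eq))
  char0 (suc m) (suc n) eq = cong suc (char0 m n (GroupProperties.∙-cancelˡ +-group 1# _ _ eq))

  √≈0⇒≈0 : ∀ {x} → 0# ≤ x → √ x ≈ 0# → x ≈ 0#
  √≈0⇒≈0 0≤x √x≈0 = ≈-trans (≈-sym (√-square 0≤x)) (≈-trans (*-congʳ √x≈0) (zeroˡ _))

  √-injective : ∀ {x y} → 0# ≤ x → 0# ≤ y → √ x ≈ √ y → x ≈ y
  √-injective 0≤x 0≤y eq = ≈-trans (≈-sym (√-square 0≤x)) (≈-trans (*-cong eq eq) (√-square 0≤y))

module ComplexProperties {c ℓ₁ ℓ₂} (ℝ : RealNumbers c ℓ₁ ℓ₂) where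
  open RealNumbers ℝ hiding (zero) renaming (refl to ≈-refl; sym to ≈-sym; trans to ≈-trans)
  open RealProperties ℝ
  open Complex ℝ using (_+i_; re; im; rawSemiring-ℂ; _^ᶜ_; sumᶜ; ∣_∣; _≈ᶜ_; 1ᶜ)
  open IntegerSolver commutativeRing
  open RawSemiring rawSemiring-ℂ using () renaming (_+_ to _+ᶜ_; _*_ to _*ᶜ_; 0# to 0ᶜ)

  -ᶜ_ : ℂ ℝ → ℂ ℝ
  -ᶜ z = (- re z) +i (- im z)

  isCommutativeRing-ℂ : IsCommutativeRing _≈ᶜ_ _+ᶜ_ _*ᶜ_ -ᶜ_ 0ᶜ 1ᶜ
  isCommutativeRing-ℂ = record
    { isRing = record
      { +-isAbelianGroup = record
        { isGroup = record
          { isMonoid = record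
            { isSemigroup = record
              { isMagma = record
                { isEquivalence = record
                  { refl  = ≈-refl , ≈-refl
                  ; sym   = λ (r , i) → ≈-sym r , ≈-sym i
                  ; trans = λ (r , i) (r′ , i′) → ≈-trans r r′ , ≈-trans i i′
                  }
                ; ∙-cong = λ (r , i) (r′ , i′) → +-cong r r′ , +-cong i i′
                }
              ; assoc = λ _ _ _ → +-assoc _ _ _ , +-assoc _ _ _
              }
            ; identity = (λ _ → +-identityˡ _ , +-identityˡ _) , (λ _ → +-identityʳ _ , +-identityʳ _)
            }
          ; inverse = (λ _ → -‿inverseˡ _ , -‿inverseˡ _) , (λ _ → -‿inverseʳ _ , -‿inverseʳ _)
          ; ⁻¹-cong = λ (r , i) → -‿cong r , -‿cong i
          }
        ; comm = λ _ _ → +-comm _ _ , +-comm _ _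
        }
      ; *-cong = λ (r , i) (r′ , i′) → +-cong (*-cong r r′) (-‿cong (*-cong i i′)) , +-cong (*-cong r i′) (*-cong i r′)
      ; *-assoc = λ (a +i b) (a′ +i b′) (a″ +i b″) →
          solve 6 (λ a b a′ b′ a″ b″ → (a :* a′ :- b :* b′) :* a″ :- (a :* b′ :+ b :* a′) :* b″
            := a :* (a′ :* a″ :- b′ :* b″) :- b :* (a′ :* b″ :+ b′ :* a″)) ≈-refl a b a′ b′ a″ b″ ,
          solve 6 (λ a b a′ b′ a″ b″ → (a :* a′ :- b :* b′) :* b″ :+ (a :* b′ :+ b :* a′) :* a″
            := a :* (a′ :* b″ :+ b′ :* a″) :+ b :* (a′ :* a″ :- b′ :* b″)) ≈-refl a b a′ b′ a″ b″
      ; *-identity = *-identityˡ-ℂ , λ z → ≈ᶜ-trans (*-comm-ℂ z 1ᶜ) (*-identityˡ-ℂ z)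
      ; distrib = (λ (a +i b) (a′ +i b′) (a″ +i b″) →
          solve 6 (λ a b a′ b′ a″ b″ → a :* (a′ :+ a″) :- b :* (b′ :+ b″)
            := (a :* a′ :- b :* b′) :+ (a :* a″ :- b :* b″)) ≈-refl a b a′ b′ a″ b″ ,
          solve 6 (λ a b a′ b′ a″ b″ → a :* (b′ :+ b″) :+ b :* (a′ :+ a″)
            := (a :* b′ :+ b :* a′) :+ (a :* b″ :+ b :* a″)) ≈-refl a b a′ b′ a″ b″) ,
          (λ (a +i b) (a′ +i b′) (a″ +i b″) →
          solve 6 (λ a b a′ b′ a″ b″ → (a′ :+ a″) :* a :- (b′ :+ b″) :* b
            := (a′ :* a :- b′ :* b) :+ (a″ :* a :- b″ :* b)) ≈-refl a b a′ b′ a″ b″ ,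
          solve 6 (λ a b a′ b′ a″ b″ → (a′ :+ a″) :* b :+ (b′ :+ b″) :* a
            := (a′ :* b :+ b′ :* a) :+ (a″ :* b :+ b″ :* a)) ≈-refl a b a′ b′ a″ b″)
      }
    ; *-comm = *-comm-ℂ
    }
    where
    ≈ᶜ-trans : ∀ {z w v} → z ≈ᶜ w → w ≈ᶜ v → z ≈ᶜ v
    ≈ᶜ-trans (r , i) (r′ , i′) = ≈-trans r r′ , ≈-trans i i′
    *-comm-ℂ : ∀ z w → z *ᶜ w ≈ᶜ w *ᶜ z
    *-comm-ℂ (a +i b) (a′ +i b′) =
      solve 4 (λ a b a′ b′ → a :* a′ :- b :* b′ := a′ :* a :- b′ :* b) ≈-refl a b a′ b′ ,
      solve 4 (λ a b a′ b′ → a :* b′ :+ b :* a′ := a′ :* b :+ b′ :* a) ≈-refl a b a′ b′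
    *-identityˡ-ℂ : ∀ z → 1ᶜ *ᶜ z ≈ᶜ z
    *-identityˡ-ℂ (a +i b) =
      ≈-trans (+-cong (*-identityˡ a) (≈-trans (-‿cong (zeroˡ b)) (solve 0 (:- con 0ℤ := con 0ℤ) ≈-refl))) (+-identityʳ a) ,
      ≈-trans (+-cong (*-identityˡ b) (zeroˡ a)) (+-identityʳ b)

  commutativeRing-ℂ : CommutativeRing _ _
  commutativeRing-ℂ = record { isCommutativeRing = isCommutativeRing-ℂ }

  module ℂR = CommutativeRing commutativeRing-ℂ
  open SemiringMult ℂR.semiring using () renaming (_×_ to _·ᶜ_)

  conj : ℂ ℝ → ℂ ℝ
  conj z = re z +i (- im z)

  norm : ℂ ℝ → Carrier
  norm z = re z * re z + im z * im z

  norm-nonneg : ∀ z → 0# ≤ norm z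
  norm-nonneg z = +-nonneg (square-nonneg (re z)) (square-nonneg (im z))

  *-conj : ∀ z → z *ᶜ conj z ≈ᶜ norm z +i 0#
  *-conj (a +i b) =
    solve 2 (λ a b → a :* a :- b :* (:- b) := a :* a :+ b :* b) ≈-refl a b ,
    solve 2 (λ a b → a :* (:- b) :+ b :* a := con 0ℤ) ≈-refl a b

  conj-+ : ∀ z w → conj (z +ᶜ w) ≈ᶜ conj z +ᶜ conj w
  conj-+ (a +i b) (a′ +i b′) = ≈-refl , solve 2 (λ b b′ → :- (b :+ b′) := :- b :+ :- b′) ≈-refl b b′

  norm-* : ∀ z w → norm (z *ᶜ w) ≈ norm z * norm w
  norm-* (a +i b) (a′ +i b′) = solve 4 (λ a b a′ b′ →
    (a :* a′ :- b :* b′) :* (a :* a′ :- b :* b′) :+ (a :* b′ :+ b :* a′) :* (a :* b′ :+ b :* a′)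
    := (a :* a :+ b :* b) :* (a′ :* a′ :+ b′ :* b′)) ≈-refl a b a′ b′

  -- Multiplying `z w = 0` by the conjugate of `z` leaves the real number `norm z` times each
  -- coordinate of `w`, which reduces the claim to the reals.
  noZeroDivisors-ℂ : ∀ {z w} → ¬ z ≈ᶜ 0ᶜ → z *ᶜ w ≈ᶜ 0ᶜ → w ≈ᶜ 0ᶜ
  noZeroDivisors-ℂ {z@(a +i b)} {w@(a′ +i b′)} z≉0 (r , i) = noZeroDivisors norm≉0 (re≈0) , noZeroDivisors norm≉0 im≈0
    where
    open import Relation.Binary.Reasoning.Setoid setoid
    norm≉0 : ¬ norm z ≈ 0#
    norm≉0 eq = z≉0 (squares≈0 eq , squares≈0 (≈-trans (+-comm _ _) eq))
    re≈0 : norm z * a′ ≈ 0#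
    re≈0 = begin
      norm z * a′
        ≈⟨ solve 4 (λ a b a′ b′ → (a :* a :+ b :* b) :* a′ := a :* (a :* a′ :- b :* b′) :+ b :* (a :* b′ :+ b :* a′)) ≈-refl a b a′ b′ ⟩
      a * (a * a′ - b * b′) + b * (a * b′ + b * a′)                ≈⟨ +-cong (*-congˡ r) (*-congˡ i) ⟩
      a * 0# + b * 0#                                              ≈⟨ ≈-trans (+-cong (zeroʳ a) (zeroʳ b)) (+-identityʳ 0#) ⟩
      0#                                                           ∎
    im≈0 : norm z * b′ ≈ 0#
    im≈0 = begin
      norm z * b′
        ≈⟨ solve 4 (λ a b a′ b′ → (a :* a :+ b :* b) :* b′ := a :* (a :* b′ :+ b :* a′) :- b :* (a :* a′ :- b :* b′)) ≈-refl a b a′ b′ ⟩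
      a * (a * b′ + b * a′) - b * (a * a′ - b * b′)                ≈⟨ +-cong (*-congˡ i) (-‿cong (*-congˡ r)) ⟩
      a * 0# - b * 0#
        ≈⟨ solve 2 (λ a b → a :* con 0ℤ :- b :* con 0ℤ := con 0ℤ) ≈-refl a b ⟩
      0#                                                           ∎

  ·-re : ∀ m → m ·ᶜ 1ᶜ ≈ᶜ fromℕ m +i 0#
  ·-re zero    = ≈-refl , ≈-refl
  ·-re (suc m) = +-congˡ (proj₁ (·-re m)) , ≈-trans (+-identityˡ _) (proj₂ (·-re m))

  char0-ℂ : CharacteristicZero commutativeRing-ℂ
  char0-ℂ m n eq = char0 m n (≈-trans (≈-sym (proj₁ (·-re m))) (≈-trans (proj₁ eq) (proj₁ (·-re n))))

  open SemiringExp semiring using (_^_)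

  norm-1 : norm 1ᶜ ≈ 1#
  norm-1 = ≈-trans (+-cong (*-identityˡ 1#) (zeroˡ 0#)) (+-identityʳ 1#)

  norm-^ : ∀ z k → norm (z ^ᶜ k) ≈ norm z ^ k
  norm-^ z zero    = norm-1
  norm-^ z (suc k) = ≈-trans (norm-* z (z ^ᶜ k)) (*-congˡ (norm-^ z k))

  norm-cong : ∀ {z w} → z ≈ᶜ w → norm z ≈ norm w
  norm-cong (r , i) = +-cong (*-cong r r) (*-cong i i)

  -- With x = norm z, all powers of x are norms, so 1 + x + … + x^m is positive and 1 - x^(m+1) = 0 forces x = 1.
  norm-root≈1 : ∀ z m → z ^ᶜ suc m ≈ᶜ 1ᶜ → norm z ≈ 1#
  norm-root≈1 z m z^m≈1 = ≈-sym (x∙y⁻¹≈ε⇒x≈y 1# x (noZeroDivisors (geometric≉0 m) (begin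
    geometric m * (1# - x)      ≈⟨ telescope m ⟩
    1# - x ^ suc m
      ≈⟨ x≈y⇒x∙y⁻¹≈ε (≈-sym (≈-trans (≈-sym (norm-^ z (suc m))) (≈-trans (norm-cong z^m≈1) norm-1))) ⟩
    0#                          ∎)))
    where
    open import Relation.Binary.Reasoning.Setoid setoid
    open GroupProperties +-group using (x∙y⁻¹≈ε⇒x≈y; x≈y⇒x∙y⁻¹≈ε)
    x : Carrier
    x = norm z
    geometric : ℕ → Carrier
    geometric zero    = 1#
    geometric (suc k) = geometric k + x ^ suc k
    power-nonneg : ∀ k → 0# ≤ x ^ k
    power-nonneg k x^k<0 = norm-nonneg (z ^ᶜ k) (<-respˡ (≈-sym (norm-^ z k)) x^k<0)
    geometric-pos : ∀ k → 0# < geometric k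
    geometric-pos zero    = 0<1
    geometric-pos (suc k) = 0<pos+nonneg (geometric-pos k) (power-nonneg (suc k))
    geometric≉0 : ∀ k → ¬ geometric k ≈ 0#
    geometric≉0 k eq = IsStrictPartialOrder.irrefl isStrictPartialOrder (≈-sym eq) (geometric-pos k)
    telescope : ∀ k → geometric k * (1# - x) ≈ 1# - x ^ suc k
    telescope zero    = ≈-trans (*-identityˡ _) (+-congˡ (-‿cong (≈-sym (*-identityʳ x))))
    telescope (suc k) = begin
      (geometric k + x ^ suc k) * (1# - x)                  ≈⟨ distribʳ _ _ _ ⟩
      geometric k * (1# - x) + x ^ suc k * (1# - x)
        ≈⟨ +-cong (telescope k) (solve 3 (λ y e x → y :* (e :- x) := y :* e :- x :* y) ≈-refl (x ^ suc k) 1# x) ⟩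
      (1# - x ^ suc k) + (x ^ suc k * 1# - x * x ^ suc k)   ≈⟨ +-congˡ (+-congʳ (*-identityʳ _)) ⟩
      (1# - x ^ suc k) + (x ^ suc k - x * x ^ suc k)
        ≈⟨ solve 3 (λ e y v → (e :- y) :+ (y :- v) := e :- v) ≈-refl 1# (x ^ suc k) (x * x ^ suc k) ⟩
      1# - x ^ suc (suc k)                                  ∎

  -- On the unit circle conjugation is inversion.
  conj-inverse : ∀ {z w} → norm z ≈ 1# → z *ᶜ w ≈ᶜ 1ᶜ → conj z ≈ᶜ w
  conj-inverse {z} {w} norm≈1 zw≈1 = begin
    conj z                    ≈⟨ ℂR.*-identityʳ (conj z) ⟨
    conj z *ᶜ 1ᶜ              ≈⟨ ℂR.*-congˡ {conj z} zw≈1 ⟨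
    conj z *ᶜ (z *ᶜ w)        ≈⟨ ℂR.*-assoc (conj z) z w ⟨
    conj z *ᶜ z *ᶜ w          ≈⟨ ℂR.*-congʳ {w} (ℂR.trans (ℂR.*-comm (conj z) z) (ℂR.trans (*-conj z) (norm≈1 , ≈-refl))) ⟩
    1ᶜ *ᶜ w                   ≈⟨ ℂR.*-identityˡ w ⟩
    w                         ∎
    where open import Relation.Binary.Reasoning.Setoid ℂR.setoid

  conj-sum : ∀ {m} (t : Fin m → ℂ ℝ) → conj (sumᶜ t) ≈ᶜ sumᶜ (λ i → conj (t i))
  conj-sum {zero}  t = ≈-refl , GroupProperties.ε⁻¹≈ε +-group
  conj-sum {suc m} t = ℂR.trans (conj-+ (t zero) (sumᶜ (t ∘ suc))) (ℂR.+-congˡ {conj (t zero)} (conj-sum (t ∘ suc)))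

  *-conj-∣∣≈0 : ∀ z → ∣ z ∣ ≈ 0# → z *ᶜ conj z ≈ᶜ 0ᶜ
  *-conj-∣∣≈0 z ∣z∣≈0 = ℂR.trans (*-conj z) (√≈0⇒≈0 (norm-nonneg z) ∣z∣≈0 , ≈-refl)

  *-conj-∣∣≈√ : ∀ z m → ∣ z ∣ ≈ √ (fromℕ m) → z *ᶜ conj z ≈ᶜ m ·ᶜ 1ᶜ
  *-conj-∣∣≈√ z m ∣z∣≈√m = ℂR.trans (*-conj z)
    (ℂR.trans (√-injective (norm-nonneg z) (fromℕ-nonneg m) ∣z∣≈√m , ≈-refl) (ℂR.sym (·-re m)))

-- Parity of powers

open import Data.Nat using (_^_)

odd-* : ∀ {m n} → Odd m → Odd n → Odd (m ℕ.* n)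
odd-* (k , refl) (l , refl) = k ℕ.+ l ℕ.+ 2 ℕ.* k ℕ.* l ,
  solve 2 (λ k l → (con 1 :+ con 2 :* k) :* (con 1 :+ con 2 :* l) := con 1 :+ con 2 :* (k :+ l :+ con 2 :* k :* l)) refl k l
  where open +-*-Solver

odd-^ : ∀ {m} → Odd m → ∀ k → Odd (m ^ k)
odd-^ m-odd zero    = 0 , refl
odd-^ m-odd (suc k) = odd-* m-odd (odd-^ m-odd k)

2∤⇒odd : ∀ {m} → ¬ 2 ∣ m → Odd m
2∤⇒odd {m} 2∤m with m % 2 | m%n<n m 2 | m≡m%n+[m/n]*n m 2
... | 0           | _               | m≡ = contradiction (divides (m / 2) m≡) 2∤m
... | 1           | _               | m≡ = m / 2 , trans m≡ (cong suc (ℕ.*-comm (m / 2) 2))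
... | suc (suc _) | s≤s (s≤s ())    | _

-- Even planar functions are 2-to-1

module _ {q} (𝔽 : FiniteField q) where
  open FieldProperties 𝔽

  -- From `- x ≡ x` with `x` invertible one gets `2 · 1# ≡ 0#`; together with `p · 1# ≡ 0#` for
  -- `p = 1 + 2k` this would give `1# ≡ 0#`.
  oddCharacteristic⇒x≢-x : ∀ {p} → Odd p → p · 1# ≡ 0# → ∀ {x} → x ≢ 0# → - x ≢ x
  oddCharacteristic⇒x≢-x (k , refl) p·1≡0 {x} x≢0 -x≡x = 0≢1 (begin
    0#                              ≡⟨ p·1≡0 ⟨
    1# + (2 ℕ.* k) · 1#             ≡⟨ cong (λ m → 1# + m · 1#) (ℕ.*-comm 2 k) ⟩
    1# + (k ℕ.* 2) · 1#             ≡⟨ cong (1# +_) (×-assocˡ 1# k 2) ⟨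
    1# + k · (2 · 1#)               ≡⟨ cong (λ t → 1# + k · t) 2·1≡0 ⟩
    1# + k · 0#                     ≡⟨ cong (1# +_) (k·0 k) ⟩
    1# + 0#                         ≡⟨ +-identityʳ 1# ⟩
    1#                              ∎)
    where
    open ≡.≡-Reasoning
    k·0 : ∀ k → k · 0# ≡ 0#
    k·0 zero    = refl
    k·0 (suc k) = trans (+-identityˡ _) (k·0 k)
    2·1≡0 : 2 · 1# ≡ 0#
    2·1≡0 = *-cancelˡ-nonZero x≢0 (begin
      x * (2 · 1#)      ≡⟨ ×-comm-* 2 x 1# ⟩
      2 · (x * 1#)      ≡⟨ cong (2 ·_) (*-identityʳ x) ⟩
      x + (x + 0#)      ≡⟨ cong (x +_) (+-identityʳ x) ⟩
      x + x             ≡⟨ cong (_+ x) -x≡x ⟨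
      - x + x           ≡⟨ -‿inverseˡ x ⟩
      0#                ∎)

  module _ (F : Carrier → Carrier) (planar : Planar 𝔽 F) (even : Even 𝔽 F) where
    open ≡.≡-Reasoning

    -- Both x and - y solve F (z + a) - F z ≡ 0 for a = y - x.
    planar-even-fibre : ∀ {x y} → F x ≡ F y → x ≡ y ⊎ - x ≡ y
    planar-even-fibre {x} {y} Fx≡Fy with x ≟ y
    ... | yes x≡y = inj₁ x≡y
    ... | no x≢y with z , _ , unique ← planar (y - x) (λ y-x≡0 → x≢y (sym (x∙y⁻¹≈ε⇒x≈y y x y-x≡0))) 0# =
      inj₂ (begin
        - x          ≡⟨ cong -_ (trans (sym (unique x-solution)) (unique -y-solution)) ⟩
        - (- y)      ≡⟨ ⁻¹-involutive y ⟩
        y            ∎)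
      where
      open import Algebra.Properties.Group +-group using (⁻¹-involutive)
      x-solution : F (x + (y - x)) - F x ≡ 0#
      x-solution = x≈y⇒x∙y⁻¹≈ε (begin
        F (x + (y - x))      ≡⟨ cong F (solve 2 (λ x y → x :+ (y :- x) := y) refl x y) ⟩
        F y                  ≡⟨ Fx≡Fy ⟨
        F x                  ∎)
      -y-solution : F (- y + (y - x)) - F (- y) ≡ 0#
      -y-solution = x≈y⇒x∙y⁻¹≈ε (begin
        F (- y + (y - x))    ≡⟨ cong F (solve 2 (λ x y → :- y :+ (y :- x) := :- x) refl x y) ⟩
        F (- x)              ≡⟨ even x ⟨
        F x                  ≡⟨ Fx≡Fy ⟩
        F y                  ≡⟨ even y ⟩
        F (- y)              ∎)

    module _ (h : ℕ) (q≡1+2h : q ≡ 1 ℕ.+ 2 ℕ.* h) (x≢-x : ∀ {x} → x ≢ 0# → - x ≢ x) where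
      open Fibres 𝔽
      open TwoToOneShape 𝔽 h q≡1+2h F using (pre; one; two; shape⇒twoToOne)
      open Inverse enumeration using (to; strictlyInverseʳ)

      ∑-𝟙 : ∀ a → ∑ (λ z → 𝟙 (a ≟ z)) ≡ 1
      ∑-𝟙 a = trans (∑-cong (λ z → sym (trans (·≡* (𝟙 (a ≟ z)) 1) (ℕ.*-identityʳ _))))
                    (FibreSum.∑-δ 𝔽 ℕ.+-0-commutativeMonoid (λ _ → 1) a)

      -0≡0 : - 0# ≡ 0#
      -0≡0 = trans (sym (+-identityˡ (- 0#))) (-‿inverseʳ 0#)

      -- A nonempty fibre is `{x , - x}` for any of its elements `x`. It is a single point exactly
      -- when `x` is 0, so the value `F 0#` accounts for the only fibre of size 1.
      fibre : ∀ y → (pre y ≡ 1 × F 0# ≡ y) ⊎ ((pre y ≡ 0 ⊎ pre y ≡ 2) × F 0# ≢ y)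
      fibre y with any? (λ i → F (element i) ≟ y)
      ... | no ∄ = inj₂ (inj₁ pre≡0 , λ F0≡y → ∉image 0# F0≡y)
        where
        ∉image : ∀ x → F x ≢ y
        ∉image x Fx≡y = ∄ (to x , trans (cong F (strictlyInverseʳ x)) Fx≡y)
        pre≡0 : pre y ≡ 0
        pre≡0 = trans (count≡∑ _) (∑-ε (λ x → 𝟙-no (F x ≟ y) (∉image x)))
      ... | yes (i , Fx≡y) = by-cases (x ≟ 0#)
        where
        x = element i
        by-cases : Dec (x ≡ 0#) → (pre y ≡ 1 × F 0# ≡ y) ⊎ ((pre y ≡ 0 ⊎ pre y ≡ 2) × F 0# ≢ y)
        by-cases (yes x≡0) = inj₁ (trans (count≡∑ _) (trans (∑-cong (λ z → indicator (F z ≟ y) (0# ≟ z))) (∑-𝟙 0#)) , F0≡y)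
          where
          F0≡y : F 0# ≡ y
          F0≡y = trans (cong F (sym x≡0)) Fx≡y
          indicator : ∀ {z} (Fz≟y : Dec (F z ≡ y)) (0≟z : Dec (0# ≡ z)) → 𝟙 Fz≟y ≡ 𝟙 0≟z
          indicator (yes _)    (yes _)   = refl
          indicator (no _)     (no _)    = refl
          indicator (no Fz≢y)  (yes 0≡z) = contradiction (trans (cong F (sym 0≡z)) F0≡y) Fz≢y
          indicator (yes Fz≡y) (no 0≢z) with planar-even-fibre (trans F0≡y (sym Fz≡y))
          ... | inj₁ 0≡z  = contradiction 0≡z 0≢z
          ... | inj₂ -0≡z = contradiction (trans (sym -0≡0) -0≡z) 0≢z
        by-cases (no x≢0) = inj₂ (inj₂ (begin
            pre y                                              ≡⟨ count≡∑ _ ⟩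
            ∑ (λ z → 𝟙 (F z ≟ y))                              ≡⟨ ∑-cong (λ z → indicator (F z ≟ y) (x ≟ z) (- x ≟ z)) ⟩
            ∑ (λ z → 𝟙 (x ≟ z) ℕ.+ 𝟙 (- x ≟ z))                ≡⟨ ∑-∙ _ _ ⟩
            ∑ (λ z → 𝟙 (x ≟ z)) ℕ.+ ∑ (λ z → 𝟙 (- x ≟ z))      ≡⟨ cong₂ ℕ._+_ (∑-𝟙 x) (∑-𝟙 (- x)) ⟩
            2                                                  ∎) , F0≢y)
          where
          F0≢y : F 0# ≢ y
          F0≢y F0≡y with planar-even-fibre (trans F0≡y (sym Fx≡y))
          ... | inj₁ 0≡x  = x≢0 (sym 0≡x)
          ... | inj₂ -0≡x = x≢0 (trans (sym -0≡x) -0≡0)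
          indicator : ∀ {z} (Fz≟y : Dec (F z ≡ y)) (x≟z : Dec (x ≡ z)) (-x≟z : Dec (- x ≡ z)) → 𝟙 Fz≟y ≡ 𝟙 x≟z ℕ.+ 𝟙 -x≟z
          -- The two indicators never overlap: `x ≡ - x` is excluded for nonzero `x` in odd
          -- characteristic.
          indicator _          (yes x≡z) (yes -x≡z) = contradiction (trans -x≡z (sym x≡z)) (x≢-x x≢0)
          indicator (yes _)    (yes _)   (no _)     = refl
          indicator (yes _)    (no _)    (yes _)    = refl
          indicator (no _)     (no _)    (no _)     = refl
          indicator (no Fz≢y)  (yes x≡z) (no _)     = contradiction (trans (cong F (sym x≡z)) Fx≡y) Fz≢y
          indicator (no Fz≢y)  (no _)    (yes -x≡z) =
            contradiction (trans (cong F (sym -x≡z)) (trans (sym (even x)) Fx≡y)) Fz≢y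
          indicator (yes Fz≡y) (no x≢z)  (no -x≢z) with planar-even-fibre (trans Fx≡y (sym Fz≡y))
          ... | inj₁ x≡z  = contradiction x≡z x≢z
          ... | inj₂ -x≡z = contradiction -x≡z -x≢z

      planar⇒twoToOne : TwoToOne 𝔽 F
      planar⇒twoToOne = shape⇒twoToOne ∑-one shape
        where
        shape-of : ∀ {m} n → n ≡ m → 𝟙 (m ℕ.≟ 1) ℕ.+ (𝟙 (m ℕ.≟ 2) ℕ.+ 𝟙 (m ℕ.≟ 2)) ≡ m → 𝟙 (n ℕ.≟ 1) ℕ.+ (𝟙 (n ℕ.≟ 2) ℕ.+ 𝟙 (n ℕ.≟ 2)) ≡ n
        shape-of n refl eq = eq
        shape : ∀ y → one y ℕ.+ (two y ℕ.+ two y) ≡ pre y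
        shape y with fibre y
        ... | inj₁ (pre≡1 , _)        = shape-of (pre y) pre≡1 refl
        ... | inj₂ (inj₁ pre≡0 , _)   = shape-of (pre y) pre≡0 refl
        ... | inj₂ (inj₂ pre≡2 , _)   = shape-of (pre y) pre≡2 refl
        one≡ : ∀ y → one y ≡ 𝟙 (F 0# ≟ y)
        one≡ y with fibre y
        ... | inj₁ (pre≡1 , F0≡y)       = trans (𝟙-yes (pre y ℕ.≟ 1) pre≡1) (sym (𝟙-yes (F 0# ≟ y) F0≡y))
        ... | inj₂ (inj₁ pre≡0 , F0≢y)  =
          trans (𝟙-no (pre y ℕ.≟ 1) (λ pre≡1 → contradiction (trans (sym pre≡0) pre≡1) (λ ()))) (sym (𝟙-no (F 0# ≟ y) F0≢y))
        ... | inj₂ (inj₂ pre≡2 , F0≢y)  =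
          trans (𝟙-no (pre y ℕ.≟ 1) (λ pre≡1 → contradiction (trans (sym pre≡2) pre≡1) (λ ()))) (sym (𝟙-no (F 0# ≟ y) F0≢y))
        ∑-one : ∑ one ≡ 1
        ∑-one = trans (∑-cong one≡) (∑-𝟙 (F 0#))

-- The Walsh transform as a character sum

module WalshTransform {c ℓ₁ ℓ₂} (ℝ : RealNumbers c ℓ₁ ℓ₂) (p n : ℕ) (p-prime : Prime p)
  (ζ : ℂ ℝ) (ζ-primitive : IsPrimitiveRoot ℝ p ζ) (𝔽 : FiniteField (p ^ n)) where
  open RealNumbers ℝ using (1#; _≈_)
  open Complex ℝ using (_≈ᶜ_; _^ᶜ_; 1ᶜ)
  open ComplexProperties ℝ
  private
    module K = FieldProperties 𝔽
    module ℝR = RealNumbers ℝ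
  open Trace {p} {n} p-prime 𝔽 using (tr; res; tr-+; tr-neg)
  open TraceCharacter commutativeRing-ℂ {p} {n} p-prime 𝔽 using (χ; isNontrivialCharacter)

  χ₁ : K.Carrier → ℂ ℝ
  χ₁ = χ noZeroDivisors-ℂ ζ (proj₁ ζ-primitive) (proj₂ ζ-primitive)

  isCharacter : IsNontrivialCharacter commutativeRing-ℂ 𝔽 χ₁
  isCharacter = isNontrivialCharacter noZeroDivisors-ℂ ζ (proj₁ ζ-primitive) (proj₂ ζ-primitive)

  open CharacterSums commutativeRing-ℂ 𝔽 χ₁ isCharacter using (W; W̄)
  open IsNontrivialCharacter isCharacter
  open FiniteSum ℂR.+-commutativeMonoid K.enumeration

  norm-ζ≈1 : norm ζ ≈ 1#
  norm-ζ≈1 =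
    norm-root≈1 ζ (ℕ.pred p) (≡.subst (λ k → ζ ^ᶜ k ≈ᶜ 1ᶜ) (sym (ℕ.suc-pred p {{prime⇒nonZero p-prime}})) (proj₁ ζ-primitive))

  -- `χ₁ x` is a power of `ζ`, hence of norm 1, and its inverse is `χ₁ (- x)` by additivity.
  conj-χ : ∀ x → conj (χ₁ x) ≈ᶜ χ₁ (K.- x)
  conj-χ x = conj-inverse (ℝR.trans (norm-^ ζ (res (tr x))) (ℝR.trans (^-congˡ (res (tr x)) norm-ζ≈1) (1^ (res (tr x)))))
    (ℂR.trans (ℂR.sym (χ-+ x (K.- x))) (ℂR.trans (ℂR.reflexive (cong χ₁ (K.-‿inverseʳ x))) χ-0))
    where
    open SemiringExp ℝR.semiring using (^-congˡ) renaming (_^_ to _^ᴿ_)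
    1^ : ∀ k → 1# ^ᴿ k ≈ 1#
    1^ zero    = ℝR.refl
    1^ (suc k) = ℝR.trans (ℝR.*-identityˡ _) (1^ k)

  walsh : (K.Carrier → K.Carrier) → K.Carrier → K.Carrier → ℂ ℝ
  walsh = Walsh {p} {n} 𝔽 ℝ ζ

  -- The Walsh transform subtracts two traces, `W` takes the trace of a difference; additivity of
  -- the trace identifies the exponents of `ζ`.
  walsh≡W : ∀ F b a → walsh F b a ≡ W F b a
  walsh≡W F b a = trans (sum-cong-≗ (λ i → cong (λ t → ζ ^ᶜ res t) (tr-difference (K.element i)))) (sym (∑≡sum _))
    where
    open import Algebra.Properties.Monoid.Sum ℂR.+-monoid using (sum-cong-≗)
    tr-difference : ∀ x → tr (b K.* F x) K.- tr (a K.* x) ≡ tr (b K.* F x K.- a K.* x)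
    tr-difference x = trans (cong (tr (b K.* F x) K.+_) (sym (tr-neg (a K.* x)))) (sym (tr-+ (b K.* F x) (K.- (a K.* x))))

  conj-W : ∀ F b a → conj (W F b a) ≈ᶜ W̄ F b a
  conj-W F b a =
    ℂR.trans (ℂR.reflexive (cong conj (∑≡sum _))) (ℂR.trans (conj-sum {p ^ n} ((λ x → χ₁ (b K.* F x K.- a K.* x)) ∘ K.element))
    (ℂR.trans (ℂR.reflexive (sym (∑≡sum (λ x → conj (χ₁ (b K.* F x K.- a K.* x)))))) (∑-cong (λ x → conj-χ (b K.* F x K.- a K.* x)))))

  W*W̄ : ∀ F b a {z} → walsh F b a ℂR.* conj (walsh F b a) ≈ᶜ z → W F b a ℂR.* W̄ F b a ≈ᶜ z
  W*W̄ F b a {z} eq = ℂR.trans (ℂR.*-congˡ {W F b a} (ℂR.sym (conj-W F b a)))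
    (≡.subst (λ w → w ℂR.* conj w ≈ᶜ z) (walsh≡W F b a) eq)

corollary6p5 : ∀ {c ℓ₁ ℓ₂} (ℝ : RealNumbers c ℓ₁ ℓ₂) (p n : ℕ) → Prime p → ¬ (2 ∣ p) →
    (ζ : ℂ ℝ) → IsPrimitiveRoot ℝ p ζ →
    (𝔽 : FiniteField (p ^ n)) →
    (F : FiniteField.Carrier 𝔽 → FiniteField.Carrier 𝔽) →
    Plateaued {p} {n} 𝔽 ℝ ζ F → Even 𝔽 F →
    Planar 𝔽 F ⇔ TwoToOne 𝔽 F
corollary6p5 ℝ p n p-prime 2∤p ζ ζ-primitive 𝔽 F plateaued even = mk⇔
  (λ planar → planar⇒twoToOne 𝔽 F planar even h q≡1+2h (oddCharacteristic⇒x≢-x 𝔽 p-odd ι-p))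
  (λ twoToOne → planar twoToOne squares)
  where
  p-odd : Odd p
  p-odd = 2∤⇒odd 2∤p
  h : ℕ
  h = proj₁ (odd-^ p-odd n)
  q≡1+2h : p ^ n ≡ 1 ℕ.+ 2 ℕ.* h
  q≡1+2h = proj₂ (odd-^ p-odd n)
  open Trace {p} {n} p-prime 𝔽 using (ι-p)
  open ComplexProperties ℝ
  open WalshTransform ℝ p n p-prime ζ ζ-primitive 𝔽
  open PlateauedTwoToOne commutativeRing-ℂ char0-ℂ 𝔽 h q≡1+2h χ₁ isCharacter F using (PlateauedSquares; planar)
  squares : PlateauedSquares
  squares b b≢0 with s , _ , values ← plateaued b b≢0 =
    -- The squared plateau height `p ^ (n + s)` is a natural number, odd as a power of `p` and at
    -- least `p ^ n`. Working with squares removes the square root and the half-integral exponent.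
    p ^ (n ℕ.+ s) , (odd-^ p-odd (n ℕ.+ s) , ℕ.^-monoʳ-≤ p {{prime⇒nonZero p-prime}} (ℕ.m≤m+n n s)) , λ a →
      Sum.map (λ ≈0 → W*W̄ F b a (*-conj-∣∣≈0 (walsh F b a) ≈0))
              (λ ≈√ → W*W̄ F b a (*-conj-∣∣≈√ (walsh F b a) (p ^ (n ℕ.+ s)) ≈√)) (values a)
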